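{- If the prime-depleted Szpiro conjecture is true over $\mathbb{Q}$, then the prime-depleted $ABC$-conjecture is true. That is: suppose there exist an integer $J\ge 0$ and a constant $C_3$ such that $$\sigma_J\bigl(\mathfrak{D}(E/\mathbb{Q})\bigr)\le C_3$$ for all elliptic curves $E/\mathbb{Q}$. Then there exist an integer $J'\ge 0$ and a constant $C_5$ such that for all nonzero integers $A,B,C\in\mathbb{Z}$ satisfying $A+B+C=0$ and $\gcd(A,B,C)=1$, $$\sigma_{J'}(ABC)\le C_5 .$$
   Context: Here $\mathfrak{D}(E/\mathbb{Q})$ denotes the minimal discriminant of $E/\mathbb{Q}$, regarded as a nonzero integer up to sign (equivalently, an ideal of $\mathbb{Z}$). Szpiro ratio: for a nonzero integer $D$ with $|D|=\prod_{i=1}^{\nu(D)}p_i^{e_i}$, the $p_i$ distinct primes and $e_i\ge1$, where $\nu(D)$ is the number of distinct primes dividing $D$, set $$\sigma(D)=\frac{\sum_i e_i\log p_i}{\sum_i\log p_i},\qquad \sigma(\pm1)=1.$$ $J$-depleted Szpiro ratio: for an integer $J\ge 0$, $$\sigma_J(D)=\min_{\substack{I\subset\{1,\dots,\nu(D)\}\\ \#I\ge \nu(D)-J}}\ \sigma\Bigl(\prod_{i\in I}p_i^{e_i}\Bigr).$$ In particular $\sigma_J(D)=1$ if $\nu(D)\le J$. -}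

module Defs where

open import Data.Fin.Base using (Fin)
open import Data.Fin.Subset as Subset using (Subset; ⊤; inside; outside)
open import Data.Fin.Subset.Properties using (_∈?_)
open import Data.Integer.Base as ℤ using (ℤ; +_)
import Data.Integer.GCD as ℤ
import Data.Integer.Properties as ℤ
open import Data.Integer.Solver using () renaming (module +-*-Solver to ℤ-Solver)
open import Data.List.Base
  using (List; []; _∷_; map; _++_; foldr; filter; length; lookup; allFin; deduplicate)
open import Data.List.Membership.Propositional.Properties using (∈-lookup)
open import Data.List.Relation.Unary.All as All using (All; []; _∷_)
import Data.List.Relation.Unary.All.Properties as All
open import Data.Nat.Base as ℕ using (ℕ; zero; suc; _∸_; _^_)
open import Data.Nat.Divisibility using (_∣_)
open import Data.Nat.ListAction using (product)
open import Data.Nat.ListAction.Properties using (product≢0)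
import Data.Nat.Properties as ℕ
open import Data.Nat.Primality using (Prime; prime⇒nonZero; prime⇒nonTrivial)
open import Data.Nat.Primality.Factorisation
  using (PrimeFactorisation; factors; factorise)
open import Data.Product.Base using (∃; _×_; _,_)
open import Data.Rational.Base as ℚ
  using (ℚ; 0ℚ; 1ℚ; _+_; _*_; _-_; -_; _/_; 1/_; _⊓_; _≤_; _<_; ↥_; ↧ₙ_)
import Data.Rational.Properties as ℚ
import Data.Rational.Unnormalised.Base as ℚᵘ
import Data.Rational.Unnormalised.Properties as ℚᵘ
open import Data.Rational.Solver using (module +-*-Solver)
open import Data.Sum.Base using (inj₁; inj₂)
open import Data.Vec.Base using ([]; _∷_)
open import Function.Base using (_∘_)
open import Relation.Binary.PropositionalEquality
  using (_≡_; refl; sym; trans; cong; cong₂; module ≡-Reasoning)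
open import Relation.Nullary using (¬_; yes; no; contradiction)

------------------------------------------------------------------------
-- Real numbers as Cauchy sequences of rationals.  Two sequences with the
-- same limit are not identified; everything below only uses _≤ᴿ_, which
-- depends on the limits alone.

IsCauchy : (ℕ → ℚ) → Set
IsCauchy x = ∀ ε → 0ℚ < ε →
  ∃ λ N → ∀ m n → N ℕ.≤ m → N ℕ.≤ n → ℚ.∣ x m - x n ∣ ≤ ε

record ℝ : Set where
  constructor real
  field
    seq    : ℕ → ℚ
    cauchy : IsCauchy seq

open ℝ public

infix 4 _≤ᴿ_

_≤ᴿ_ : ℝ → ℝ → Set
x ≤ᴿ y = ∀ ε → 0ℚ < ε → ∃ λ N → ∀ n → N ℕ.≤ n → seq x n ≤ seq y n + ε

IsPositive : ℝ → Set
IsPositive x = ∃ λ δ → 0ℚ < δ × ∃ λ N → ∀ n → N ℕ.≤ n → δ ≤ seq x n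

∣-∣≤⇒≤+ : ∀ a b {ε} → ℚ.∣ a - b ∣ ≤ ε → a ≤ b + ε
∣-∣≤⇒≤+ a b {ε} h = begin
  a             ≡⟨ solve 2 (λ a b → a := b :+ (a :- b)) refl a b ⟩
  b + (a - b)   ≤⟨ ℚ.+-monoʳ-≤ b (ℚ.≤-trans (p≤∣p∣ (a - b)) h) ⟩
  b + ε         ∎
  where
  open ℚ.≤-Reasoning
  open +-*-Solver
  p≤∣p∣ : ∀ p → p ≤ ℚ.∣ p ∣
  p≤∣p∣ p with ℚ.≤-total 0ℚ p
  ... | inj₁ 0≤p = ℚ.≤-reflexive (sym (ℚ.0≤p⇒∣p∣≡p 0≤p))
  ... | inj₂ p≤0 = ℚ.≤-trans p≤0 (ℚ.0≤∣p∣ p)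

≤+⇒∣-∣≤ : ∀ a b {ε} → a ≤ b + ε → b ≤ a + ε → ℚ.∣ a - b ∣ ≤ ε
≤+⇒∣-∣≤ a b {ε} h k with ℚ.∣p∣≡p∨∣p∣≡-p (a - b)
... | inj₁ eq = begin
  ℚ.∣ a - b ∣   ≡⟨ eq ⟩
  a - b         ≤⟨ ℚ.+-monoˡ-≤ (- b) h ⟩
  b + ε - b     ≡⟨ solve 2 (λ b e → b :+ e :- b := e) refl b ε ⟩
  ε             ∎
  where
  open ℚ.≤-Reasoning
  open +-*-Solver
... | inj₂ eq = begin
  ℚ.∣ a - b ∣   ≡⟨ eq ⟩
  - (a - b)     ≡⟨ solve 2 (λ a b → :- (a :- b) := b :- a) refl a b ⟩
  b - a         ≤⟨ ℚ.+-monoˡ-≤ (- a) k ⟩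
  a + ε - a     ≡⟨ solve 2 (λ a e → a :+ e :- a := e) refl a ε ⟩
  ε             ∎
  where
  open ℚ.≤-Reasoning
  open +-*-Solver

-- By symmetry in m and n a one-sided estimate is enough.
mkCauchy : ∀ x →
  (∀ ε → 0ℚ < ε → ∃ λ N → ∀ m n → N ℕ.≤ m → N ℕ.≤ n → x m ≤ x n + ε) →
  IsCauchy x
mkCauchy x h ε 0<ε with h ε 0<ε
... | N , f = N , λ m n N≤m N≤n →
  ≤+⇒∣-∣≤ (x m) (x n) (f m n N≤m N≤n) (f n m N≤n N≤m)

0<⇒0<1/ : ∀ {p} (0<p : 0ℚ < p) → 0ℚ < (1/ p) {{ℚ.>-nonZero 0<p}}
0<⇒0<1/ {p} 0<p = ℚ.positive⁻¹ _ {{ℚ.1/pos⇒pos p {{ℚ.positive 0<p}}}}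

0<p*q : ∀ {p q} → 0ℚ < p → 0ℚ < q → 0ℚ < p * q
0<p*q {p} {q} 0<p 0<q =
  ℚ.positive⁻¹ _ {{ℚ.pos*pos⇒pos p {{ℚ.positive 0<p}} q {{ℚ.positive 0<q}}}}

0<p+q : ∀ {p q} → 0ℚ < p → 0ℚ < q → 0ℚ < p + q
0<p+q {p} {q} 0<p 0<q =
  ℚ.positive⁻¹ _ {{ℚ.pos+pos⇒pos p {{ℚ.positive 0<p}} q {{ℚ.positive 0<q}}}}

-- It is enough to bound the differences by K * ε for a fixed K.
scaleCauchy : ∀ x K → 0ℚ < K →
  (∀ ε → 0ℚ < ε →
    ∃ λ N → ∀ m n → N ℕ.≤ m → N ℕ.≤ n → ℚ.∣ x m - x n ∣ ≤ K * ε) →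
  IsCauchy x
scaleCauchy x K 0<K h ε 0<ε
  with h (ε * 1/K) (0<p*q 0<ε (0<⇒0<1/ 0<K))
  where 1/K = (1/ K) {{ℚ.>-nonZero 0<K}}
... | N , f = N , λ m n N≤m N≤n → ℚ.≤-trans (f m n N≤m N≤n) (ℚ.≤-reflexive K*ε/K≡ε)
  where
  instance _ = ℚ.>-nonZero 0<K
  K*ε/K≡ε : K * (ε * 1/ K) ≡ ε
  K*ε/K≡ε = begin
    K * (ε * 1/ K) ≡⟨ solve 3 (λ k e i → k :* (e :* i) := e :* (k :* i)) refl K ε (1/ K) ⟩
    ε * (K * 1/ K) ≡⟨ cong (ε *_) (ℚ.*-inverseʳ K) ⟩
    ε * 1ℚ         ≡⟨ ℚ.*-identityʳ ε ⟩
    ε              ∎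
    where
    open ≡-Reasoning
    open +-*-Solver

eventuallyBounded : ∀ x → IsCauchy x →
  ∃ λ B → 0ℚ < B × ∃ λ N → ∀ n → N ℕ.≤ n → ℚ.∣ x n ∣ ≤ B
eventuallyBounded x c with c 1ℚ (ℚ.positive⁻¹ 1ℚ)
... | N , f = ℚ.∣ x N ∣ + 1ℚ , 0<B , N , bound
  where
  0<B : 0ℚ < ℚ.∣ x N ∣ + 1ℚ
  0<B = ℚ.+-mono-≤-< (ℚ.0≤∣p∣ (x N)) (ℚ.positive⁻¹ 1ℚ)
  bound : ∀ n → N ℕ.≤ n → ℚ.∣ x n ∣ ≤ ℚ.∣ x N ∣ + 1ℚ
  bound n N≤n = begin
    ℚ.∣ x n ∣                   ≡⟨ cong ℚ.∣_∣ (solve 2 (λ a b → a := b :+ (a :- b)) refl (x n) (x N)) ⟩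
    ℚ.∣ x N + (x n - x N) ∣     ≤⟨ ℚ.∣p+q∣≤∣p∣+∣q∣ (x N) (x n - x N) ⟩
    ℚ.∣ x N ∣ + ℚ.∣ x n - x N ∣ ≤⟨ ℚ.+-monoʳ-≤ ℚ.∣ x N ∣ (f n N N≤n ℕ.≤-refl) ⟩
    ℚ.∣ x N ∣ + 1ℚ              ∎
    where
    open ℚ.≤-Reasoning
    open +-*-Solver

*-mono-≤-0≤ : ∀ {a b c d} → 0ℚ ≤ c → 0ℚ ≤ b → a ≤ b → c ≤ d → a * c ≤ b * d
*-mono-≤-0≤ {a} {b} {c} {d} 0≤c 0≤b a≤b c≤d = ℚ.≤-trans
  (ℚ.*-monoʳ-≤-nonNeg c {{ℚ.nonNegative 0≤c}} a≤b)
  (ℚ.*-monoˡ-≤-nonNeg b {{ℚ.nonNegative 0≤b}} c≤d)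

+-interchange : ∀ a b c d → (a + b) - (c + d) ≡ (a - c) + (b - d)
+-interchange = solve 4 (λ a b c d → (a :+ b) :- (c :+ d) := (a :- c) :+ (b :- d)) refl
  where open +-*-Solver

∣+-+∣≤ : ∀ a b c d {ε} → ℚ.∣ a - c ∣ ≤ ε → ℚ.∣ b - d ∣ ≤ ε →
         ℚ.∣ (a + b) - (c + d) ∣ ≤ (1ℚ + 1ℚ) * ε
∣+-+∣≤ a b c d {ε} h k = begin
  ℚ.∣ (a + b) - (c + d) ∣     ≡⟨ cong ℚ.∣_∣ (+-interchange a b c d) ⟩
  ℚ.∣ (a - c) + (b - d) ∣     ≤⟨ ℚ.∣p+q∣≤∣p∣+∣q∣ (a - c) (b - d) ⟩
  ℚ.∣ a - c ∣ + ℚ.∣ b - d ∣   ≤⟨ ℚ.+-mono-≤ h k ⟩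
  ε + ε                       ≡⟨ cong₂ _+_ (ℚ.*-identityˡ ε) (ℚ.*-identityˡ ε) ⟨
  1ℚ * ε + 1ℚ * ε             ≡⟨ ℚ.*-distribʳ-+ ε 1ℚ 1ℚ ⟨
  (1ℚ + 1ℚ) * ε               ∎
  where open ℚ.≤-Reasoning

*-difference : ∀ a b c d → a * b - c * d ≡ a * (b - d) + d * (a - c)
*-difference = solve 4 (λ a b c d → a :* b :- c :* d := a :* (b :- d) :+ d :* (a :- c)) refl
  where open +-*-Solver

∣*-*∣≤ : ∀ a b c d {A B ε} → 0ℚ ≤ A → 0ℚ ≤ B → ℚ.∣ a ∣ ≤ A → ℚ.∣ d ∣ ≤ B →
         ℚ.∣ a - c ∣ ≤ ε → ℚ.∣ b - d ∣ ≤ ε → ℚ.∣ a * b - c * d ∣ ≤ (A + B) * ε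
∣*-*∣≤ a b c d {A} {B} {ε} 0≤A 0≤B ∣a∣≤A ∣d∣≤B h k = begin
  ℚ.∣ a * b - c * d ∣
    ≡⟨ cong ℚ.∣_∣ (*-difference a b c d) ⟩
  ℚ.∣ a * (b - d) + d * (a - c) ∣
    ≤⟨ ℚ.∣p+q∣≤∣p∣+∣q∣ (a * (b - d)) (d * (a - c)) ⟩
  ℚ.∣ a * (b - d) ∣ + ℚ.∣ d * (a - c) ∣
    ≡⟨ cong₂ _+_ (ℚ.∣p*q∣≡∣p∣*∣q∣ a (b - d)) (ℚ.∣p*q∣≡∣p∣*∣q∣ d (a - c)) ⟩
  ℚ.∣ a ∣ * ℚ.∣ b - d ∣ + ℚ.∣ d ∣ * ℚ.∣ a - c ∣
    ≤⟨ ℚ.+-mono-≤ (*-mono-≤-0≤ (ℚ.0≤∣p∣ (b - d)) 0≤A ∣a∣≤A k)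
                  (*-mono-≤-0≤ (ℚ.0≤∣p∣ (a - c)) 0≤B ∣d∣≤B h) ⟩
  A * ε + B * ε
    ≡⟨ ℚ.*-distribʳ-+ ε A B ⟨
  (A + B) * ε ∎
  where open ℚ.≤-Reasoning

const-cauchy : ∀ q → IsCauchy (λ _ → q)
const-cauchy q = mkCauchy (λ _ → q) λ ε 0<ε → 0 , λ _ _ _ _ →
  ℚ.≤-trans (ℚ.≤-reflexive (sym (ℚ.+-identityʳ q))) (ℚ.+-monoʳ-≤ q (ℚ.<⇒≤ 0<ε))

+-cauchy : ∀ x y → IsCauchy x → IsCauchy y → IsCauchy (λ n → x n + y n)
+-cauchy x y cx cy = scaleCauchy (λ n → x n + y n) (1ℚ + 1ℚ) (ℚ.positive⁻¹ (1ℚ + 1ℚ)) prf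
  where
  prf : ∀ ε → 0ℚ < ε → ∃ λ N → ∀ m n → N ℕ.≤ m → N ℕ.≤ n →
        ℚ.∣ (x m + y m) - (x n + y n) ∣ ≤ (1ℚ + 1ℚ) * ε
  prf ε 0<ε = let (N , f) = cx ε 0<ε; (M , g) = cy ε 0<ε in
    N ℕ.+ M , λ m n h k → ∣+-+∣≤ (x m) (y m) (x n) (y n)
      (f m n (ℕ.m+n≤o⇒m≤o N h) (ℕ.m+n≤o⇒m≤o N k))
      (g m n (ℕ.m+n≤o⇒n≤o N h) (ℕ.m+n≤o⇒n≤o N k))

*-cauchy : ∀ x y → IsCauchy x → IsCauchy y → IsCauchy (λ n → x n * y n)
*-cauchy x y cx cy =
  let (A , 0<A , N₁ , ∣x∣≤A) = eventuallyBounded x cx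
      (B , 0<B , N₂ , ∣y∣≤B) = eventuallyBounded y cy
  in scaleCauchy (λ n → x n * y n) (A + B) (0<p+q 0<A 0<B) λ ε 0<ε →
  let (N₃ , f) = cx ε 0<ε
      (N₄ , g) = cy ε 0<ε
  in (N₁ ℕ.+ N₂) ℕ.+ (N₃ ℕ.+ N₄) , λ m n h k →
  let h₁ = ℕ.m+n≤o⇒m≤o (N₁ ℕ.+ N₂) h
      h₂ = ℕ.m+n≤o⇒n≤o (N₁ ℕ.+ N₂) h
      k₁ = ℕ.m+n≤o⇒m≤o (N₁ ℕ.+ N₂) k
      k₂ = ℕ.m+n≤o⇒n≤o (N₁ ℕ.+ N₂) k
  in ∣*-*∣≤ (x m) (y m) (x n) (y n) (ℚ.<⇒≤ 0<A) (ℚ.<⇒≤ 0<B)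
       (∣x∣≤A m (ℕ.m+n≤o⇒m≤o N₁ h₁))
       (∣y∣≤B n (ℕ.m+n≤o⇒n≤o N₁ k₁))
       (f m n (ℕ.m+n≤o⇒m≤o N₃ h₂) (ℕ.m+n≤o⇒m≤o N₃ k₂))
       (g m n (ℕ.m+n≤o⇒n≤o N₃ h₂) (ℕ.m+n≤o⇒n≤o N₃ k₂))

⊓-cauchy : ∀ x y → IsCauchy x → IsCauchy y → IsCauchy (λ n → x n ⊓ y n)
⊓-cauchy x y cx cy = mkCauchy (λ n → x n ⊓ y n) λ ε 0<ε →
  let (N , f) = cx ε 0<ε; (M , g) = cy ε 0<ε in
  N ℕ.+ M , λ m n h k → ℚ.≤-trans
    (ℚ.⊓-mono-≤
      (∣-∣≤⇒≤+ (x m) (x n) (f m n (ℕ.m+n≤o⇒m≤o N h) (ℕ.m+n≤o⇒m≤o N k)))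
      (∣-∣≤⇒≤+ (y m) (y n) (g m n (ℕ.m+n≤o⇒n≤o N h) (ℕ.m+n≤o⇒n≤o N k))))
    (ℚ.≤-reflexive (sym (ℚ.mono-≤-distrib-⊓ {_+ ε} (ℚ.+-monoˡ-≤ ε) (x n) (y n))))

fromℚ : ℚ → ℝ
fromℚ q = real (λ _ → q) (const-cauchy q)

fromℕ : ℕ → ℝ
fromℕ n = fromℚ (+ n / 1)

infixl 6 _+ᴿ_
infixl 7 _*ᴿ_ _⊓ᴿ_

_+ᴿ_ : ℝ → ℝ → ℝ
x +ᴿ y = real (λ n → seq x n + seq y n) (+-cauchy (seq x) (seq y) (cauchy x) (cauchy y))

_*ᴿ_ : ℝ → ℝ → ℝ
x *ᴿ y = real (λ n → seq x n * seq y n) (*-cauchy (seq x) (seq y) (cauchy x) (cauchy y))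

_⊓ᴿ_ : ℝ → ℝ → ℝ
x ⊓ᴿ y = real (λ n → seq x n ⊓ seq y n) (⊓-cauchy (seq x) (seq y) (cauchy x) (cauchy y))

-- Total on ℚ so that it can be applied termwise; the terms of a positive
-- real are nonzero from some index on.
invℚ : ℚ → ℚ
invℚ q with q ℚ.≟ 0ℚ
... | yes _   = 0ℚ
... | no  q≢0 = (1/ q) {{ℚ.≢-nonZero q≢0}}

invℚ-inverse : ∀ {q} → 0ℚ < q → q * invℚ q ≡ 1ℚ
invℚ-inverse {q} 0<q with q ℚ.≟ 0ℚ
... | yes q≡0 = contradiction (sym q≡0) (ℚ.<⇒≢ 0<q)
... | no  q≢0 = ℚ.*-inverseʳ q {{ℚ.≢-nonZero q≢0}}

0<invℚ : ∀ {q} → 0ℚ < q → 0ℚ < invℚ q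
0<invℚ {q} 0<q with q ℚ.≟ 0ℚ
... | yes q≡0 = contradiction (sym q≡0) (ℚ.<⇒≢ 0<q)
... | no  _ = 0<⇒0<1/ 0<q

rearrange₁ : ∀ q i j → q * i * j ≡ i * (q * j)
rearrange₁ = solve 3 (λ q i j → q :* i :* j := i :* (q :* j)) refl
  where open +-*-Solver

rearrange₂ : ∀ p q i j → i * (q * j) - j * (p * i) ≡ (q - p) * (i * j)
rearrange₂ = solve 4 (λ p q i j → i :* (q :* j) :- j :* (p :* i) := (q :- p) :* (i :* j)) refl
  where open +-*-Solver

invℚ-anti : ∀ {p q} → 0ℚ < p → p ≤ q → invℚ q ≤ invℚ p
invℚ-anti {p} {q} 0<p p≤q = begin
  j             ≡⟨ ℚ.*-identityˡ j ⟨
  1ℚ * j        ≡⟨ cong (_* j) (invℚ-inverse 0<p) ⟨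
  p * i * j     ≤⟨ ℚ.*-monoʳ-≤-nonNeg j {{ℚ.nonNegative (ℚ.<⇒≤ (0<invℚ 0<q))}}
                    (ℚ.*-monoʳ-≤-nonNeg i {{ℚ.nonNegative (ℚ.<⇒≤ (0<invℚ 0<p))}} p≤q) ⟩
  q * i * j     ≡⟨ rearrange₁ q i j ⟩
  i * (q * j)   ≡⟨ cong (i *_) (invℚ-inverse 0<q) ⟩
  i * 1ℚ        ≡⟨ ℚ.*-identityʳ i ⟩
  i             ∎
  where
  open ℚ.≤-Reasoning
  0<q = ℚ.<-≤-trans 0<p p≤q
  i   = invℚ p
  j   = invℚ q

invℚ-diff : ∀ {p q} → 0ℚ < p → 0ℚ < q → invℚ p - invℚ q ≡ (q - p) * (invℚ p * invℚ q)
invℚ-diff {p} {q} 0<p 0<q = begin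
  i - j                     ≡⟨ cong₂ _-_ (ℚ.*-identityʳ i) (ℚ.*-identityʳ j) ⟨
  i * 1ℚ - j * 1ℚ           ≡⟨ cong₂ (λ a b → i * a - j * b) (invℚ-inverse 0<q) (invℚ-inverse 0<p) ⟨
  i * (q * j) - j * (p * i) ≡⟨ rearrange₂ p q i j ⟩
  (q - p) * (i * j)         ∎
  where
  open ≡-Reasoning
  i = invℚ p
  j = invℚ q

∣invℚ-invℚ∣≤ : ∀ p q {δ ε} → 0ℚ < δ → 0ℚ < ε → δ ≤ p → δ ≤ q → ℚ.∣ q - p ∣ ≤ ε →
               ℚ.∣ invℚ p - invℚ q ∣ ≤ invℚ δ * invℚ δ * ε
∣invℚ-invℚ∣≤ p q {δ} {ε} 0<δ 0<ε δ≤p δ≤q h = begin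
  ℚ.∣ i - j ∣                   ≡⟨ cong ℚ.∣_∣ (invℚ-diff 0<p 0<q) ⟩
  ℚ.∣ (q - p) * (i * j) ∣       ≡⟨ ℚ.∣p*q∣≡∣p∣*∣q∣ (q - p) (i * j) ⟩
  ℚ.∣ q - p ∣ * ℚ.∣ i * j ∣     ≡⟨ cong (ℚ.∣ q - p ∣ *_) (ℚ.0≤p⇒∣p∣≡p 0≤ij) ⟩
  ℚ.∣ q - p ∣ * (i * j)         ≤⟨ *-mono-≤-0≤ 0≤ij (ℚ.<⇒≤ 0<ε) h
                                     (*-mono-≤-0≤ (ℚ.<⇒≤ (0<invℚ 0<q)) (ℚ.<⇒≤ (0<invℚ 0<δ))
                                       (invℚ-anti 0<δ δ≤p) (invℚ-anti 0<δ δ≤q)) ⟩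
  ε * (k * k)                   ≡⟨ ℚ.*-comm ε (k * k) ⟩
  k * k * ε                     ∎
  where
  open ℚ.≤-Reasoning
  0<p  = ℚ.<-≤-trans 0<δ δ≤p
  0<q  = ℚ.<-≤-trans 0<δ δ≤q
  i    = invℚ p
  j    = invℚ q
  k    = invℚ δ
  0≤ij = ℚ.<⇒≤ (0<p*q (0<invℚ 0<p) (0<invℚ 0<q))

inverse-cauchy : ∀ x → IsCauchy x → ∀ δ → 0ℚ < δ → ∀ M → (∀ n → M ℕ.≤ n → δ ≤ x n) →
                 IsCauchy (λ n → invℚ (x n))
inverse-cauchy x cx δ 0<δ M δ≤x =
  scaleCauchy (λ n → invℚ (x n)) (invℚ δ * invℚ δ) (0<p*q (0<invℚ 0<δ) (0<invℚ 0<δ)) λ ε 0<ε →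
  let (N , f) = cx ε 0<ε in
  N ℕ.+ M , λ m n h l → ∣invℚ-invℚ∣≤ (x m) (x n) 0<δ 0<ε
    (δ≤x m (ℕ.m+n≤o⇒n≤o N h)) (δ≤x n (ℕ.m+n≤o⇒n≤o N l))
    (f n m (ℕ.m+n≤o⇒m≤o N l) (ℕ.m+n≤o⇒m≤o N h))

inverse : (x : ℝ) → IsPositive x → ℝ
inverse x (δ , 0<δ , M , δ≤x) =
  real (λ n → invℚ (seq x n)) (inverse-cauchy (seq x) (cauchy x) δ 0<δ M δ≤x)

sumᴿ : List ℝ → ℝ
sumᴿ = foldr _+ᴿ_ (fromℕ 0)

------------------------------------------------------------------------

∑ : ℕ → (ℕ → ℚ) → ℚ
∑ zero    f = 0ℚ
∑ (suc n) f = f 0 + ∑ n (f ∘ suc)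

-- The lower Riemann sum of ∫₁ⁿ dt/t with mesh 1/K, where K = suc k:
--   Σ_{i < (n-1)K} (1/K) / (1 + (i+1)/K)  =  Σ_{i < (n-1)K} 1 / (K + i + 1).
logSum : ℕ → ℕ → ℚ
logSum n k = ∑ ((n ∸ 1) ℕ.* suc k) (λ i → + 1 / (suc k ℕ.+ suc i))

∑-mono : ∀ n {f g : ℕ → ℚ} → (∀ i → i ℕ.< n → f i ≤ g i) → ∑ n f ≤ ∑ n g
∑-mono zero    h = ℚ.≤-refl
∑-mono (suc n) h = ℚ.+-mono-≤ (h 0 (ℕ.s≤s ℕ.z≤n)) (∑-mono n λ i i<n → h (suc i) (ℕ.s≤s i<n))

∑-cong : ∀ n {f g : ℕ → ℚ} → (∀ i → f i ≡ g i) → ∑ n f ≡ ∑ n g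
∑-cong zero    h = refl
∑-cong (suc n) h = cong₂ _+_ (h 0) (∑-cong n (h ∘ suc))

∑-snoc : ∀ n f → ∑ (suc n) f ≡ ∑ n f + f n
∑-snoc zero    f = ℚ.+-comm (f 0) 0ℚ
∑-snoc (suc n) f = trans (cong (_+_ (f 0)) (∑-snoc n (f ∘ suc))) (sym (ℚ.+-assoc (f 0) _ _))

∑-++ : ∀ m n f → ∑ (m ℕ.+ n) f ≡ ∑ m f + ∑ n (λ i → f (m ℕ.+ i))
∑-++ zero    n f = sym (ℚ.+-identityˡ _)
∑-++ (suc m) n f = trans (cong (_+_ (f 0)) (∑-++ m n (f ∘ suc))) (sym (ℚ.+-assoc (f 0) _ _))

∑-block : ∀ m n f → ∑ (m ℕ.* n) f ≡ ∑ m (λ i → ∑ n (λ j → f (i ℕ.* n ℕ.+ j)))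
∑-block zero    n f = refl
∑-block (suc m) n f = trans (∑-++ n (m ℕ.* n) f) (cong (_+_ (∑ n f))
  (trans (∑-block m n (λ i → f (n ℕ.+ i)))
         (∑-cong m λ i → ∑-cong n λ j → cong f (sym (ℕ.+-assoc n (i ℕ.* n) j)))))

/≤/ : ∀ a b c d → a ℕ.* suc d ℕ.≤ c ℕ.* suc b → + a / suc b ≤ + c / suc d
/≤/ a b c d h = ℚ.toℚᵘ-cancel-≤ (begin
  ℚ.toℚᵘ (+ a / suc b)  ≃⟨ ℚ.toℚᵘ-fromℚᵘ (ℚᵘ.mkℚᵘ (+ a) b) ⟩
  ℚᵘ.mkℚᵘ (+ a) b       ≤⟨ ℚᵘ.*≤* (toℤ h) ⟩
  ℚᵘ.mkℚᵘ (+ c) d       ≃⟨ ℚ.toℚᵘ-fromℚᵘ (ℚᵘ.mkℚᵘ (+ c) d) ⟨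
  ℚ.toℚᵘ (+ c / suc d)  ∎)
  where
  open ℚᵘ.≤-Reasoning
  toℤ : a ℕ.* suc d ℕ.≤ c ℕ.* suc b → + a ℤ.* + suc d ℤ.≤ + c ℤ.* + suc b
  toℤ h rewrite sym (ℤ.pos-* a (suc d)) | sym (ℤ.pos-* c (suc b)) = ℤ.+≤+ h

0≤/ : ∀ a b → 0ℚ ≤ + a / suc b
0≤/ a b = /≤/ 0 0 a b ℕ.z≤n

unit-anti : ∀ {a b} → a ℕ.≤ b → + 1 / suc b ≤ + 1 / suc a
unit-anti {a} {b} a≤b = /≤/ 1 b 1 a (ℕ.+-monoˡ-≤ 0 (ℕ.s≤s a≤b))

unit-+ : ∀ a b → + 1 / suc b + + a / suc b ≡ + suc a / suc b
unit-+ a b = ℚ.toℚᵘ-injective (begin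
  ℚ.toℚᵘ (+ 1 / suc b + + a / suc b)
    ≈⟨ ℚ.toℚᵘ-homo-+ (+ 1 / suc b) (+ a / suc b) ⟩
  ℚ.toℚᵘ (+ 1 / suc b) ℚᵘ.+ ℚ.toℚᵘ (+ a / suc b)
    ≈⟨ ℚᵘ.+-cong (ℚ.toℚᵘ-fromℚᵘ (ℚᵘ.mkℚᵘ (+ 1) b)) (ℚ.toℚᵘ-fromℚᵘ (ℚᵘ.mkℚᵘ (+ a) b)) ⟩
  ℚᵘ.mkℚᵘ (+ 1) b ℚᵘ.+ ℚᵘ.mkℚᵘ (+ a) b
    ≈⟨ ℚᵘ.*≡* (identity (+ suc b) (+ a)) ⟩
  ℚᵘ.mkℚᵘ (+ suc a) b
    ≈⟨ ℚ.toℚᵘ-fromℚᵘ (ℚᵘ.mkℚᵘ (+ suc a) b) ⟨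
  ℚ.toℚᵘ (+ suc a / suc b) ∎)
  where
  open import Relation.Binary.Reasoning.Setoid ℚᵘ.≃-setoid
  identity : ∀ d a → (+ 1 ℤ.* d ℤ.+ a ℤ.* d) ℤ.* d ≡ (+ 1 ℤ.+ a) ℤ.* (d ℤ.* d)
  identity = solve 2 (λ d a → (con (+ 1) :* d :+ a :* d) :* d := (con (+ 1) :+ a) :* (d :* d)) refl
    where open ℤ-Solver

∑-const : ∀ n b → ∑ n (λ _ → + 1 / suc b) ≡ + n / suc b
∑-const zero    b = sym (ℚ.0/n≡0 (suc b))
∑-const (suc n) b = trans (cong (_+_ (+ 1 / suc b)) (∑-const n b)) (unit-+ n b)

-- l + a * suc l is the predecessor of suc a * suc l.
∑-units : ∀ a l → ∑ (suc l) (λ _ → + 1 / suc (l ℕ.+ a ℕ.* suc l)) ≡ + 1 / suc a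
∑-units a l = trans (∑-const (suc l) (l ℕ.+ a ℕ.* suc l)) (ℚ.fromℚᵘ-cong
  {ℚᵘ.mkℚᵘ (+ suc l) (l ℕ.+ a ℕ.* suc l)} {ℚᵘ.mkℚᵘ (+ 1) a}
  (ℚᵘ.*≡* (cong +_ (trans (ℕ.*-comm (suc l) (suc a)) (sym (ℕ.*-identityˡ _))))))

module _ (n k l : ℕ) where

  private
    M  = (n ∸ 1) ℕ.* suc k
    kl = l ℕ.+ k ℕ.* suc l

    logSum-blocks : logSum n kl ≡
      ∑ M (λ i → ∑ (suc l) (λ j → + 1 / (suc kl ℕ.+ suc (i ℕ.* suc l ℕ.+ j))))
    logSum-blocks = trans
      (cong (λ m → ∑ m (λ i → + 1 / (suc kl ℕ.+ suc i))) (sym (ℕ.*-assoc (n ∸ 1) (suc k) (suc l))))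
      (∑-block M (suc l) (λ i → + 1 / (suc kl ℕ.+ suc i)))

    lower : ∀ i j → j ℕ.< suc l →
      kl ℕ.+ suc (i ℕ.* suc l ℕ.+ j) ℕ.≤ l ℕ.+ (k ℕ.+ suc i) ℕ.* suc l
    lower i j j<L = begin
      kl ℕ.+ suc (i ℕ.* suc l ℕ.+ j)
        ≡⟨ ℕ.+-assoc l (k ℕ.* suc l) _ ⟩
      l ℕ.+ (k ℕ.* suc l ℕ.+ suc (i ℕ.* suc l ℕ.+ j))
        ≡⟨ cong (λ z → l ℕ.+ (k ℕ.* suc l ℕ.+ z)) (cong suc (ℕ.+-comm (i ℕ.* suc l) j)) ⟩
      l ℕ.+ (k ℕ.* suc l ℕ.+ (suc j ℕ.+ i ℕ.* suc l))
        ≤⟨ ℕ.+-monoʳ-≤ l (ℕ.+-monoʳ-≤ (k ℕ.* suc l) (ℕ.+-monoˡ-≤ (i ℕ.* suc l) j<L)) ⟩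
      l ℕ.+ (k ℕ.* suc l ℕ.+ suc i ℕ.* suc l)
        ≡⟨ cong (l ℕ.+_) (ℕ.*-distribʳ-+ (suc l) k (suc i)) ⟨
      l ℕ.+ (k ℕ.+ suc i) ℕ.* suc l ∎
      where open ℕ.≤-Reasoning

    upper : ∀ i j →
      l ℕ.+ (k ℕ.+ i) ℕ.* suc l ℕ.≤ kl ℕ.+ suc (i ℕ.* suc l ℕ.+ j)
    upper i j = begin
      l ℕ.+ (k ℕ.+ i) ℕ.* suc l
        ≡⟨ cong (l ℕ.+_) (ℕ.*-distribʳ-+ (suc l) k i) ⟩
      l ℕ.+ (k ℕ.* suc l ℕ.+ i ℕ.* suc l)
        ≡⟨ ℕ.+-assoc l (k ℕ.* suc l) (i ℕ.* suc l) ⟨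
      kl ℕ.+ i ℕ.* suc l
        ≤⟨ ℕ.+-monoʳ-≤ kl (ℕ.m≤n⇒m≤1+n (ℕ.m≤m+n (i ℕ.* suc l) j)) ⟩
      kl ℕ.+ suc (i ℕ.* suc l ℕ.+ j) ∎
      where open ℕ.≤-Reasoning

  -- Refining the mesh increases the lower sum ...
  logSum-refine : logSum n k ≤ logSum n kl
  logSum-refine = ℚ.≤-trans
    (∑-mono M λ i _ → ℚ.≤-trans (ℚ.≤-reflexive (sym (∑-units (k ℕ.+ suc i) l)))
      (∑-mono (suc l) λ j j<L → unit-anti (lower i j j<L)))
    (ℚ.≤-reflexive (sym logSum-blocks))

  -- ... but never beyond the upper sum, which is at most 1/K larger.
  logSum-bound : logSum n kl ≤ logSum n k + + 1 / suc k
  logSum-bound = begin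
    logSum n kl
      ≡⟨ logSum-blocks ⟩
    ∑ M (λ i → ∑ (suc l) (λ j → + 1 / (suc kl ℕ.+ suc (i ℕ.* suc l ℕ.+ j))))
      ≤⟨ ∑-mono M (λ i _ → ℚ.≤-trans (∑-mono (suc l) λ j _ → unit-anti (upper i j))
           (ℚ.≤-reflexive (∑-units (k ℕ.+ i) l))) ⟩
    ∑ M h
      ≡⟨ ℚ.+-identityʳ (∑ M h) ⟨
    ∑ M h + 0ℚ
      ≤⟨ ℚ.+-monoʳ-≤ (∑ M h) (0≤/ 1 (k ℕ.+ M)) ⟩
    ∑ M h + h M
      ≡⟨ ∑-snoc M h ⟨
    h 0 + ∑ M (h ∘ suc)
      ≡⟨ ℚ.+-comm (h 0) (∑ M (h ∘ suc)) ⟩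
    logSum n k + h 0
      ≡⟨ cong (λ z → logSum n k + + 1 / suc z) (ℕ.+-identityʳ k) ⟩
    logSum n k + + 1 / suc k ∎
    where
    open ℚ.≤-Reasoning
    h : ℕ → ℚ
    h i = + 1 / suc (k ℕ.+ i)

logSum-close : ∀ n k l → logSum n k ≤ logSum n l + + 1 / suc l
logSum-close n k l = ℚ.≤-trans (logSum-refine n k l) (ℚ.≤-trans
  (ℚ.≤-reflexive (cong (logSum n) (ℕ.suc-injective (ℕ.*-comm (suc k) (suc l)))))
  (logSum-bound n l k))

-- ε ≥ 1 / denominator of ε
1/↧≤ : ∀ ε → 0ℚ < ε → + 1 / suc (ℚ.denominator-1 ε) ≤ ε
1/↧≤ (ℚ.mkℚ (+ zero) d c) 0<ε = contradiction (ℚ.positive 0<ε) λ ()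
1/↧≤ (ℚ.mkℚ ℤ.-[1+ a ] d c) 0<ε = contradiction (ℚ.positive 0<ε) λ ()
1/↧≤ ε@(ℚ.mkℚ (+ suc a) d c) 0<ε = ℚ.≤-trans
  (/≤/ 1 d (suc a) d (ℕ.*-monoˡ-≤ (suc d) {1} {suc a} (ℕ.s≤s ℕ.z≤n)))
  (ℚ.≤-reflexive (ℚ.↥p/↧p≡p ε))

logSum-cauchy : ∀ n → IsCauchy (logSum n)
logSum-cauchy n = mkCauchy (logSum n) λ ε 0<ε → ℚ.denominator-1 ε , λ k l _ N≤l →
  ℚ.≤-trans (logSum-close n k l)
    (ℚ.+-monoʳ-≤ (logSum n l) (ℚ.≤-trans (unit-anti N≤l) (1/↧≤ ε 0<ε)))

-- The natural logarithm of n ≥ 1; the junk value at n = 0 is 0.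
log : ℕ → ℝ
log n = real (logSum n) (logSum-cauchy n)

0≤∑ : ∀ n {f : ℕ → ℚ} → (∀ i → 0ℚ ≤ f i) → 0ℚ ≤ ∑ n f
0≤∑ zero    h = ℚ.≤-refl
0≤∑ (suc n) h = ℚ.+-mono-≤ (h 0) (0≤∑ n (h ∘ suc))

0≤logSum : ∀ n k → 0ℚ ≤ logSum n k
0≤logSum n k = 0≤∑ ((n ∸ 1) ℕ.* suc k) λ i → 0≤/ 1 (k ℕ.+ suc i)

½≤logSum : ∀ {p} → Prime p → ∀ k → ℚ.½ ≤ logSum p k
½≤logSum {p} pr k = begin
  ℚ.½                 ≤⟨ atLeastFirst (ℕ.*-monoˡ-≤ 1 {1} {p ∸ 1} (ℕ.∸-monoˡ-≤ 1 1<p)) ⟩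
  logSum p 0          ≤⟨ logSum-refine p 0 k ⟩
  logSum p (k ℕ.+ 0)  ≡⟨ cong (logSum p) (ℕ.+-identityʳ k) ⟩
  logSum p k          ∎
  where
  open ℚ.≤-Reasoning
  1<p : 1 ℕ.< p
  1<p = ℕ.nonTrivial⇒n>1 p {{prime⇒nonTrivial pr}}
  atLeastFirst : ∀ {n} → 1 ℕ.≤ n → ℚ.½ ≤ ∑ n (λ i → + 1 / suc (suc i))
  atLeastFirst {suc n} _ = ℚ.+-monoʳ-≤ ℚ.½ (0≤∑ n λ i → 0≤/ 1 (suc (suc i)))

0≤∑log : ∀ ps k → 0ℚ ≤ seq (sumᴿ (map log ps)) k
0≤∑log []       k = ℚ.≤-refl
0≤∑log (p ∷ ps) k = ℚ.+-mono-≤ (0≤logSum p k) (0≤∑log ps k)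

∑log-positive : ∀ p ps → Prime p → IsPositive (sumᴿ (map log (p ∷ ps)))
∑log-positive p ps pr = ℚ.½ , ℚ.positive⁻¹ ℚ.½ , 0 , λ k _ →
  ℚ.+-mono-≤ (½≤logSum pr k) (0≤∑log ps k)

------------------------------------------------------------------------

primeDivisors : (n : ℕ) → .{{_ : ℕ.NonZero n}} → List ℕ
primeDivisors n = deduplicate ℕ._≟_ (factors (factorise n))

primeDivisors-prime : (n : ℕ) .{{_ : ℕ.NonZero n}} → All Prime (primeDivisors n)
primeDivisors-prime n =
  All.deduplicate⁺ ℕ._≟_ (PrimeFactorisation.factorsPrime (factorise n))

ord : ℕ → (n : ℕ) → .{{_ : ℕ.NonZero n}} → ℕ
ord p n = length (filter (p ℕ.≟_) (factors (factorise n)))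

weightedRatio : (ps : List ℕ) → All Prime ps → (ℕ → ℕ) → ℝ
weightedRatio []          _        e = fromℕ 1
weightedRatio ps@(q ∷ qs) (pr ∷ _) e =
  sumᴿ (map (λ p → fromℕ (e p) *ᴿ log p) ps) *ᴿ
  inverse (sumᴿ (map log ps)) (∑log-positive q qs pr)

szpiro : (D : ℤ) → .{{_ : ℤ.NonZero D}} → ℝ
szpiro D = weightedRatio (primeDivisors n) (primeDivisors-prime n) (λ p → ord p n)
  where n = ℤ.∣ D ∣

subsets : ∀ n → List (Subset n)
subsets zero    = [] ∷ []
subsets (suc n) = map (outside ∷_) (subsets n) ++ map (inside ∷_) (subsets n)

module _ (D : ℤ) .{{_ : ℤ.NonZero D}} where

  private
    ps = primeDivisors ℤ.∣ D ∣

  ν : ℕ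
  ν = length ps

  primePower : Fin ν → ℕ
  primePower i = lookup ps i ^ ord (lookup ps i) ℤ.∣ D ∣

  subproduct : Subset ν → ℕ
  subproduct I = product (map primePower (filter (_∈? I) (allFin ν)))

  instance
    subproduct≢0 : ∀ {I} → ℕ.NonZero (subproduct I)
    subproduct≢0 {I} = product≢0 (All.map⁺ (All.universal primePower≢0 (filter (_∈? I) (allFin ν))))
      where
      primePower≢0 : ∀ i → ℕ.NonZero (primePower i)
      primePower≢0 i = ℕ.m^n≢0 (lookup ps i) (ord (lookup ps i) ℤ.∣ D ∣)
        {{prime⇒nonZero (All.lookup (primeDivisors-prime ℤ.∣ D ∣) (∈-lookup i))}}

  -- The full index set ⊤ always satisfies the size condition, so starting the
  -- fold there does not change the minimum.
  depletedSzpiro : ℕ → ℝ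
  depletedSzpiro J = foldr (λ I m → szpiro (+ subproduct I) ⊓ᴿ m) (szpiro (+ subproduct ⊤))
    (filter (λ I → ν ∸ J ℕ.≤? Subset.∣ I ∣) (subsets ν))

------------------------------------------------------------------------

private
  2ℚ 3ℚ 4ℚ 8ℚ 9ℚ 27ℚ : ℚ
  2ℚ  = + 2 / 1
  3ℚ  = + 3 / 1
  4ℚ  = + 4 / 1
  8ℚ  = + 8 / 1
  9ℚ  = + 9 / 1
  27ℚ = + 27 / 1

-- y² + a₁xy + a₃y = x³ + a₂x² + a₄x + a₆
record WeierstrassEquation : Set where
  field
    a₁ a₂ a₃ a₄ a₆ : ℚ

  b₂ b₄ b₆ b₈ discriminant : ℚ
  b₂ = a₁ * a₁ + 4ℚ * a₂
  b₄ = 2ℚ * a₄ + a₁ * a₃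
  b₆ = a₃ * a₃ + 4ℚ * a₆
  b₈ = a₁ * a₁ * a₆ + 4ℚ * a₂ * a₆ - a₁ * a₃ * a₄ + a₂ * a₃ * a₃ - a₄ * a₄
  discriminant =
    (- (b₂ * b₂ * b₈)) - 8ℚ * b₄ * b₄ * b₄ - 27ℚ * b₆ * b₆ + 9ℚ * b₂ * b₄ * b₆

record EllipticCurve : Set where
  field
    equation : WeierstrassEquation

  open WeierstrassEquation equation public

  field
    {{discriminant≢0}} : ℚ.NonZero discriminant

-- E′ is obtained from E by the substitution x = u²x′ + r, y = u³y′ + u²sx′ + t.
record _≅_ (E E′ : EllipticCurve) : Set where
  open EllipticCurve E
  open EllipticCurve E′ using ()
    renaming (a₁ to a₁′; a₂ to a₂′; a₃ to a₃′; a₄ to a₄′; a₆ to a₆′)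
  field
    u r s t : ℚ
    {{u≢0}} : ℚ.NonZero u
    eq₁ : u * a₁′ ≡ a₁ + 2ℚ * s
    eq₂ : u * u * a₂′ ≡ a₂ - s * a₁ + 3ℚ * r - s * s
    eq₃ : u * u * u * a₃′ ≡ a₃ + r * a₁ + 2ℚ * t
    eq₄ : u * u * u * u * a₄′ ≡
          a₄ - s * a₃ + 2ℚ * r * a₂ - (t + r * s) * a₁ + 3ℚ * r * r - 2ℚ * s * t
    eq₆ : u * u * u * u * u * u * a₆′ ≡
          a₆ + r * a₄ + r * r * a₂ + r * r * r - t * a₃ - t * t - r * t * a₁

_IntegralAt_ : ℚ → ℕ → Set
q IntegralAt p = ¬ (p ∣ ↧ₙ q)

record IsIntegralModelAt (p : ℕ) (E : EllipticCurve) : Set where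
  open EllipticCurve E
  field
    a₁-integral : a₁ IntegralAt p
    a₂-integral : a₂ IntegralAt p
    a₃-integral : a₃ IntegralAt p
    a₄-integral : a₄ IntegralAt p
    a₆-integral : a₆ IntegralAt p

ordℚ : ℕ → (q : ℚ) → .{{_ : ℚ.NonZero q}} → ℤ
ordℚ p q@record{} = + ord p ℤ.∣ ↥ q ∣ ℤ.- + ord p (↧ₙ q)

ordΔ : ℕ → EllipticCurve → ℤ
ordΔ p E = ordℚ p discriminant {{discriminant≢0}}
  where open EllipticCurve E

-- D generates the minimal discriminant ideal of E: at every prime p its
-- exponent is the least valuation of the discriminant of a p-integral
-- Weierstrass equation of E.  This determines D up to sign.
IsMinimalDiscriminant : EllipticCurve → (D : ℤ) → .{{_ : ℤ.NonZero D}} → Set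
IsMinimalDiscriminant E D = ∀ p → Prime p →
  (∃ λ E′ → E ≅ E′ × IsIntegralModelAt p E′ × ordΔ p E′ ≡ + ord p ℤ.∣ D ∣) ×
  (∀ E′ → E ≅ E′ → IsIntegralModelAt p E′ → + ord p ℤ.∣ D ∣ ℤ.≤ ordΔ p E′)

------------------------------------------------------------------------

PrimeDepletedSzpiro : Set
PrimeDepletedSzpiro = ∃ λ J → ∃ λ C₃ →
  ∀ (E : EllipticCurve) (D : ℤ) .{{_ : ℤ.NonZero D}} → IsMinimalDiscriminant E D →
  depletedSzpiro D J ≤ᴿ C₃

PrimeDepletedABC : Set
PrimeDepletedABC = ∃ λ J → ∃ λ C₅ →
  ∀ (A B C : ℤ) .{{_ : ℤ.NonZero A}} .{{_ : ℤ.NonZero B}} .{{_ : ℤ.NonZero C}} →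
  A ℤ.+ B ℤ.+ C ≡ + 0 → ℤ.gcd (ℤ.gcd A B) C ≡ + 1 →
  depletedSzpiro (A ℤ.* B ℤ.* C) {{ABC≢0 A B C}} J ≤ᴿ C₅
  where
  ABC≢0 : ∀ A B C .{{_ : ℤ.NonZero A}} .{{_ : ℤ.NonZero B}} .{{_ : ℤ.NonZero C}} →
          ℤ.NonZero (A ℤ.* B ℤ.* C)
  ABC≢0 A B C = ℤ.i*j≢0 (A ℤ.* B) C {{ℤ.i*j≢0 A B}}

{-# OPTIONS --safe #-}

-- For A + B + C = 0 the Frey curve y² = x(x - A)(x + B) has discriminant 16(ABC)² and
-- c₄ = 16(A² + AB + B²).  At an odd prime dividing ABC, coprimality makes c₄ a unit, so the
-- equation is minimal there; hence the minimal discriminant D has the same odd primes as ABC,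
-- with exponents at least as large.  If σ_J(D) ≤ M is attained on a set of primes, then deleting
-- 2 from that set costs at most a factor 2, because log 2 is at most the sum of the remaining
-- logarithms, and leaves primes of ABC.  So σ_{J+2}(ABC) ≤ 2M.

module Submission where

open import Defs

open import Data.Bool.Base using (true; false)
open import Data.Fin.Base using (zero; suc)
open import Data.Fin.Subset as Subset using (Subset; ⊤; inside; outside)
open import Data.Fin.Subset.Properties using (_∈?_; ∣⊤∣≡n)
open import Data.Integer.Base as ℤ using (ℤ; +_)
import Data.Integer.Divisibility.Signed as ℤₛ
import Data.Integer.GCD as ℤ
import Data.Integer.Properties as ℤ
open import Data.Integer.Solver using () renaming (module +-*-Solver to ℤ-Solver)
open import Data.List.Base
  using (List; []; _∷_; _++_; map; filter; length; lookup; foldr; allFin; tabulate)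
open import Data.List.Membership.Propositional using (_∈_; _∉_)
open import Data.List.Membership.Propositional.Properties
  using (∈-filter⁺; ∈-filter⁻; ∈-deduplicate⁺; ∈-deduplicate⁻; ∈-length; ∈-++⁺ˡ; ∈-++⁺ʳ; ∈-++⁻;
         ∈-map⁺; ∈-∃++)
open import Data.List.Membership.Propositional.Properties.WithK using (unique∧set⇒bag)
open import Data.List.Properties
  using (filter-++; length-++; filter-accept; filter-reject; filter-none; filter-all; map-∘;
         map-tabulate)
open import Data.List.Relation.Binary.BagAndSetEquality using (∼bag⇒↭)
open import Data.List.Relation.Binary.Permutation.Propositional as ↭ using (_↭_)
open import Data.List.Relation.Binary.Permutation.Propositional.Properties
  using (filter-↭; ↭-length)
open import Data.List.Relation.Binary.Subset.Propositional using (_⊆_)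
open import Data.List.Relation.Unary.All as All using (All; []; _∷_)
import Data.List.Relation.Unary.All.Properties as All
open import Data.List.Relation.Unary.AllPairs using ([]; _∷_)
open import Data.List.Relation.Unary.Any using (here; there)
open import Data.List.Relation.Unary.Unique.Propositional using (Unique)
import Data.List.Relation.Unary.Unique.Propositional.Properties as Unique
open import Data.Nat.Base as ℕ using (ℕ; zero; suc; _^_; _∸_)
open import Data.Nat.Coprimality using (1-coprimeTo) renaming (sym to coprime-sym)
open import Data.Nat.Divisibility as ℕ using (_∣_)
open import Data.Nat.Induction using (<-rec)
open import Data.Nat.ListAction using (product)
open import Data.Nat.ListAction.Properties using (product-++; ∈⇒∣product; product≢0)
open import Data.Nat.Primality
  using (Prime; prime[2]; prime⇒nonZero; prime⇒nonTrivial; prime⇒irreducible; euclidsLemma)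
open import Data.Nat.Primality.Factorisation
import Data.Nat.Properties as ℕ
open import Data.List.Membership.DecPropositional ℕ._≟_ using () renaming (_∈?_ to _∈ℕ?_)
open import Data.List.Relation.Unary.Unique.DecPropositional.Properties ℕ._≟_
  using (deduplicate-!)
open import Data.Product.Base using (∃; _×_; _,_; proj₁; proj₂)
open import Data.Rational.Base as ℚ
  using (ℚ; 0ℚ; 1ℚ; _+_; _*_; _-_; -_; _/_; _≤_; _<_; _⊓_; ↥_; ↧_; ↧ₙ_)
import Data.Rational.Properties as ℚ
open import Data.Rational.Solver using (module +-*-Solver)
import Data.Rational.Unnormalised.Base as ℚᵘ
import Data.Rational.Unnormalised.Properties as ℚᵘ
open import Data.Sum.Base using (_⊎_; inj₁; inj₂; [_,_])
open import Data.Vec.Base using ([]; _∷_)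
open import Function.Base using (_∘_)
open import Function.Bundles using (mk⇔)
open import Level using (0ℓ)
open import Relation.Binary.PropositionalEquality
  using (_≡_; _≢_; refl; sym; trans; cong; cong₂; subst; module ≡-Reasoning)
open import Relation.Nullary using (¬_; ¬?; yes; no; does; contradiction)
open import Relation.Nullary.Decidable using (decidable-stable)
open import Relation.Unary using (Pred; Decidable)

-- Changes of variables

-- At 2 the Frey equation need not be minimal, and the exponent of 2 in the minimal discriminant is
-- never computed. It is the least valuation over all 2-integral models, and picking a least element
-- of an undecidable set of natural numbers is possible only under a double negation. This costs
-- nothing in the end: for a Cauchy real, lying below a rational constant is stable under double
-- negation, so the final bound may be derived from a merely hypothetical `D`.
--
-- Minima and ratios of reals are compared separately at each index `k` of the approximating
-- sequences. The set of primes attaining the minimum may vary with `k`, but the bound `M` does not.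
-- What is needed of logarithms, namely nonnegativity, positivity at primes and log 2 ≤ log q for a
-- prime q, already holds for the Riemann sums `logSum` at every `k`, so no limit is taken inside
-- the argument.

c₄ : EllipticCurve → ℚ
c₄ E = b₂ * b₂ - (+ 24 / 1) * b₄
  where open EllipticCurve E

-- Four times the discriminant, with `b₈` eliminated through 4b₈ = b₂b₆ - b₄². Its behaviour under a
-- change of variables then follows from that of `b₂`, `b₄` and `b₆` alone.
4Δ : ℚ → ℚ → ℚ → ℚ
4Δ b₂ b₄ b₆ = - (b₂ * b₂ * (b₂ * b₆ - b₄ * b₄)) - + 32 / 1 * b₄ * b₄ * b₄
  - + 108 / 1 * b₆ * b₆ + + 36 / 1 * b₂ * b₄ * b₆

4*b₈ : ∀ W → let open WeierstrassEquation W in + 4 / 1 * b₈ ≡ b₂ * b₆ - b₄ * b₄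
4*b₈ W = solve 5 (λ a₁ a₂ a₃ a₄ a₆ →
  let b₂ = a₁ :* a₁ :+ con (+ 4 / 1) :* a₂
      b₄ = con (+ 2 / 1) :* a₄ :+ a₁ :* a₃
      b₆ = a₃ :* a₃ :+ con (+ 4 / 1) :* a₆
      b₈ = a₁ :* a₁ :* a₆ :+ con (+ 4 / 1) :* a₂ :* a₆ :- a₁ :* a₃ :* a₄
             :+ a₂ :* a₃ :* a₃ :- a₄ :* a₄
  in con (+ 4 / 1) :* b₈ := b₂ :* b₆ :- b₄ :* b₄) refl a₁ a₂ a₃ a₄ a₆
  where
  open WeierstrassEquation W
  open +-*-Solver

4*discriminant : ∀ W → let open WeierstrassEquation W in
  + 4 / 1 * discriminant ≡ 4Δ b₂ b₄ b₆
4*discriminant W = begin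
  + 4 / 1 * discriminant
    ≡⟨ solve 4 (λ b₂ b₄ b₆ b₈ →
         con (+ 4 / 1) :* (:- (b₂ :* b₂ :* b₈) :- con (+ 8 / 1) :* b₄ :* b₄ :* b₄
           :- con (+ 27 / 1) :* b₆ :* b₆ :+ con (+ 9 / 1) :* b₂ :* b₄ :* b₆)
         := :- (b₂ :* b₂ :* (con (+ 4 / 1) :* b₈)) :- con (+ 32 / 1) :* b₄ :* b₄ :* b₄
           :- con (+ 108 / 1) :* b₆ :* b₆ :+ con (+ 36 / 1) :* b₂ :* b₄ :* b₆)
         refl b₂ b₄ b₆ b₈ ⟩
  - (b₂ * b₂ * (+ 4 / 1 * b₈)) - + 32 / 1 * b₄ * b₄ * b₄
    - + 108 / 1 * b₆ * b₆ + + 36 / 1 * b₂ * b₄ * b₆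
    ≡⟨ cong (λ z → - (b₂ * b₂ * z) - + 32 / 1 * b₄ * b₄ * b₄
         - + 108 / 1 * b₆ * b₆ + + 36 / 1 * b₂ * b₄ * b₆) (4*b₈ W) ⟩
  4Δ b₂ b₄ b₆ ∎
  where
  open WeierstrassEquation W
  open ≡-Reasoning
  open +-*-Solver

-- Up to a constant factor this is the discriminant of the cubic 4x³ + b₂x² + 2b₄x + b₆, and the
-- arguments on the left belong to the cubic translated by `r`; translating the roots does not
-- change their differences.
4Δ-translate : ∀ r b₂ b₄ b₆ →
  4Δ (b₂ + + 12 / 1 * r) (b₄ + r * b₂ + + 6 / 1 * r * r)
     (b₆ + + 2 / 1 * r * b₄ + r * r * b₂ + + 4 / 1 * r * r * r) ≡ 4Δ b₂ b₄ b₆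
4Δ-translate = solve 4 (λ r b₂ b₄ b₆ →
  D (b₂ :+ con (+ 12 / 1) :* r) (b₄ :+ r :* b₂ :+ con (+ 6 / 1) :* r :* r)
    (b₆ :+ con (+ 2 / 1) :* r :* b₄ :+ r :* r :* b₂ :+ con (+ 4 / 1) :* r :* r :* r)
  := D b₂ b₄ b₆) refl
  where
  open +-*-Solver
  D : Polynomial 4 → Polynomial 4 → Polynomial 4 → Polynomial 4
  D b₂ b₄ b₆ = :- (b₂ :* b₂ :* (b₂ :* b₆ :- b₄ :* b₄)) :- con (+ 32 / 1) :* b₄ :* b₄ :* b₄
    :- con (+ 108 / 1) :* b₆ :* b₆ :+ con (+ 36 / 1) :* b₂ :* b₄ :* b₆

4Δ-scale : ∀ u b₂ b₄ b₆ →
  4Δ (u * u * b₂) (u * u * u * u * b₄) (u * u * u * u * u * u * b₆) ≡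
  (u * u * u * u) * (u * u * u * u) * (u * u * u * u) * 4Δ b₂ b₄ b₆
4Δ-scale = solve 4 (λ u b₂ b₄ b₆ →
  D (u :* u :* b₂) (u :* u :* u :* u :* b₄) (u :* u :* u :* u :* u :* u :* b₆)
  := (u :* u :* u :* u) :* (u :* u :* u :* u) :* (u :* u :* u :* u) :* D b₂ b₄ b₆) refl
  where
  open +-*-Solver
  D : Polynomial 4 → Polynomial 4 → Polynomial 4 → Polynomial 4
  D b₂ b₄ b₆ = :- (b₂ :* b₂ :* (b₂ :* b₆ :- b₄ :* b₄)) :- con (+ 32 / 1) :* b₄ :* b₄ :* b₄
    :- con (+ 108 / 1) :* b₆ :* b₆ :+ con (+ 36 / 1) :* b₂ :* b₄ :* b₆

module _ {E E′ : EllipticCurve} (E≅E′ : E ≅ E′) where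
  open EllipticCurve E
  private module E′ = EllipticCurve E′
  open _≅_ E≅E′
  open ≡-Reasoning
  open +-*-Solver

  -- Completing the square in y turns the equation into one with right-hand side 4x³ + b₂x² + 2b₄x +
  -- b₆. The b-invariants therefore see only `u` and `r`, while `s` and `t` cancel here and in the
  -- next two identities.
  b₂-≅ : u * u * E′.b₂ ≡ b₂ + + 12 / 1 * r
  b₂-≅ = begin
    u * u * E′.b₂
      ≡⟨ solve 3 (λ u a₁ a₂ → u :* u :* (a₁ :* a₁ :+ con (+ 4 / 1) :* a₂)
           := (u :* a₁) :* (u :* a₁) :+ con (+ 4 / 1) :* (u :* u :* a₂)) refl u E′.a₁ E′.a₂ ⟩
    (u * E′.a₁) * (u * E′.a₁) + + 4 / 1 * (u * u * E′.a₂)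
      ≡⟨ cong₂ (λ x y → x * x + + 4 / 1 * y) eq₁ eq₂ ⟩
    (a₁ + + 2 / 1 * s) * (a₁ + + 2 / 1 * s) + + 4 / 1 * (a₂ - s * a₁ + + 3 / 1 * r - s * s)
      ≡⟨ solve 4 (λ r s a₁ a₂ →
           (a₁ :+ con (+ 2 / 1) :* s) :* (a₁ :+ con (+ 2 / 1) :* s)
             :+ con (+ 4 / 1) :* (a₂ :- s :* a₁ :+ con (+ 3 / 1) :* r :- s :* s)
           := a₁ :* a₁ :+ con (+ 4 / 1) :* a₂ :+ con (+ 12 / 1) :* r) refl r s a₁ a₂ ⟩
    b₂ + + 12 / 1 * r ∎

  b₄-≅ : u * u * u * u * E′.b₄ ≡ b₄ + r * b₂ + + 6 / 1 * r * r
  b₄-≅ = begin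
    u * u * u * u * E′.b₄
      ≡⟨ solve 4 (λ u a₁ a₃ a₄ → u :* u :* u :* u :* (con (+ 2 / 1) :* a₄ :+ a₁ :* a₃)
           := con (+ 2 / 1) :* (u :* u :* u :* u :* a₄) :+ (u :* a₁) :* (u :* u :* u :* a₃))
           refl u E′.a₁ E′.a₃ E′.a₄ ⟩
    + 2 / 1 * (u * u * u * u * E′.a₄) + (u * E′.a₁) * (u * u * u * E′.a₃)
      ≡⟨ cong₂ (λ x y → + 2 / 1 * x + y) eq₄ (cong₂ _*_ eq₁ eq₃) ⟩
    + 2 / 1 * (a₄ - s * a₃ + + 2 / 1 * r * a₂ - (t + r * s) * a₁ + + 3 / 1 * r * r
        - + 2 / 1 * s * t)
      + (a₁ + + 2 / 1 * s) * (a₃ + r * a₁ + + 2 / 1 * t)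
      ≡⟨ solve 7 (λ r s t a₁ a₂ a₃ a₄ →
           con (+ 2 / 1) :* (a₄ :- s :* a₃ :+ con (+ 2 / 1) :* r :* a₂ :- (t :+ r :* s) :* a₁
               :+ con (+ 3 / 1) :* r :* r :- con (+ 2 / 1) :* s :* t)
             :+ (a₁ :+ con (+ 2 / 1) :* s) :* (a₃ :+ r :* a₁ :+ con (+ 2 / 1) :* t)
           := con (+ 2 / 1) :* a₄ :+ a₁ :* a₃ :+ r :* (a₁ :* a₁ :+ con (+ 4 / 1) :* a₂)
             :+ con (+ 6 / 1) :* r :* r) refl r s t a₁ a₂ a₃ a₄ ⟩
    b₄ + r * b₂ + + 6 / 1 * r * r ∎

  b₆-≅ : u * u * u * u * u * u * E′.b₆ ≡
         b₆ + + 2 / 1 * r * b₄ + r * r * b₂ + + 4 / 1 * r * r * r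
  b₆-≅ = begin
    u * u * u * u * u * u * E′.b₆
      ≡⟨ solve 3 (λ u a₃ a₆ →
           u :* u :* u :* u :* u :* u :* (a₃ :* a₃ :+ con (+ 4 / 1) :* a₆)
           := (u :* u :* u :* a₃) :* (u :* u :* u :* a₃)
             :+ con (+ 4 / 1) :* (u :* u :* u :* u :* u :* u :* a₆)) refl u E′.a₃ E′.a₆ ⟩
    (u * u * u * E′.a₃) * (u * u * u * E′.a₃) + + 4 / 1 * (u * u * u * u * u * u * E′.a₆)
      ≡⟨ cong₂ (λ x y → x * x + + 4 / 1 * y) eq₃ eq₆ ⟩
    (a₃ + r * a₁ + + 2 / 1 * t) * (a₃ + r * a₁ + + 2 / 1 * t)
      + + 4 / 1 * (a₆ + r * a₄ + r * r * a₂ + r * r * r - t * a₃ - t * t - r * t * a₁)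
      ≡⟨ solve 7 (λ r t a₁ a₂ a₃ a₄ a₆ →
           (a₃ :+ r :* a₁ :+ con (+ 2 / 1) :* t) :* (a₃ :+ r :* a₁ :+ con (+ 2 / 1) :* t)
             :+ con (+ 4 / 1) :* (a₆ :+ r :* a₄ :+ r :* r :* a₂ :+ r :* r :* r :- t :* a₃
               :- t :* t :- r :* t :* a₁)
           := a₃ :* a₃ :+ con (+ 4 / 1) :* a₆
             :+ con (+ 2 / 1) :* r :* (con (+ 2 / 1) :* a₄ :+ a₁ :* a₃)
             :+ r :* r :* (a₁ :* a₁ :+ con (+ 4 / 1) :* a₂) :+ con (+ 4 / 1) :* r :* r :* r)
           refl r t a₁ a₂ a₃ a₄ a₆ ⟩
    b₆ + + 2 / 1 * r * b₄ + r * r * b₂ + + 4 / 1 * r * r * r ∎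

  private
    u⁴ = u * u * u * u

  c₄-≅ : u⁴ * c₄ E′ ≡ c₄ E
  c₄-≅ = begin
    u⁴ * c₄ E′
      ≡⟨ solve 3 (λ u b₂ b₄ → u :* u :* u :* u :* (b₂ :* b₂ :- con (+ 24 / 1) :* b₄)
           := (u :* u :* b₂) :* (u :* u :* b₂) :- con (+ 24 / 1) :* (u :* u :* u :* u :* b₄))
           refl u E′.b₂ E′.b₄ ⟩
    (u * u * E′.b₂) * (u * u * E′.b₂) - + 24 / 1 * (u * u * u * u * E′.b₄)
      ≡⟨ cong₂ (λ x y → x * x - + 24 / 1 * y) b₂-≅ b₄-≅ ⟩
    (b₂ + + 12 / 1 * r) * (b₂ + + 12 / 1 * r) - + 24 / 1 * (b₄ + r * b₂ + + 6 / 1 * r * r)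
      ≡⟨ solve 3 (λ r b₂ b₄ →
           (b₂ :+ con (+ 12 / 1) :* r) :* (b₂ :+ con (+ 12 / 1) :* r)
             :- con (+ 24 / 1) :* (b₄ :+ r :* b₂ :+ con (+ 6 / 1) :* r :* r)
           := b₂ :* b₂ :- con (+ 24 / 1) :* b₄) refl r b₂ b₄ ⟩
    c₄ E ∎

  discriminant-≅ : u⁴ * u⁴ * u⁴ * E′.discriminant ≡ discriminant
  discriminant-≅ = trans (sym (¼*4* _)) (trans (cong (+ 1 / 4 *_) 4*) (¼*4* _))
    where
    ¼*4* : ∀ x → + 1 / 4 * (+ 4 / 1 * x) ≡ x
    ¼*4* = solve 1 (λ x → con (+ 1 / 4) :* (con (+ 4 / 1) :* x) := x) refl
    4* : + 4 / 1 * (u⁴ * u⁴ * u⁴ * E′.discriminant) ≡ + 4 / 1 * discriminant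
    4* = begin
      + 4 / 1 * (u⁴ * u⁴ * u⁴ * E′.discriminant)
        ≡⟨ solve 3 (λ a x y → a :* (x :* y) := x :* (a :* y)) refl (+ 4 / 1) (u⁴ * u⁴ * u⁴) E′.discriminant ⟩
      u⁴ * u⁴ * u⁴ * (+ 4 / 1 * E′.discriminant)
        ≡⟨ cong (u⁴ * u⁴ * u⁴ *_) (4*discriminant E′.equation) ⟩
      u⁴ * u⁴ * u⁴ * 4Δ E′.b₂ E′.b₄ E′.b₆
        ≡⟨ 4Δ-scale u E′.b₂ E′.b₄ E′.b₆ ⟨
      4Δ (u * u * E′.b₂) (u * u * u * u * E′.b₄) (u * u * u * u * u * u * E′.b₆)
        ≡⟨ cong₂ (λ x f → f x) b₂-≅ (cong₂ (λ y z x → 4Δ x y z) b₄-≅ b₆-≅) ⟩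
      4Δ (b₂ + + 12 / 1 * r) (b₄ + r * b₂ + + 6 / 1 * r * r)
         (b₆ + + 2 / 1 * r * b₄ + r * r * b₂ + + 4 / 1 * r * r * r)
        ≡⟨ 4Δ-translate r b₂ b₄ b₆ ⟩
      4Δ b₂ b₄ b₆
        ≡⟨ 4*discriminant equation ⟨
      + 4 / 1 * discriminant ∎

-- Valuations

multiplicity : ℕ → List ℕ → ℕ
multiplicity p ps = length (filter (p ℕ.≟_) ps)

multiplicity-∈ : ∀ {p} ps → p ∈ ps → 0 ℕ.< multiplicity p ps
multiplicity-∈ {p} ps p∈ps = ∈-length (∈-filter⁺ (p ℕ.≟_) p∈ps refl)

multiplicity-∉ : ∀ {p} ps → p ∉ ps → multiplicity p ps ≡ 0
multiplicity-∉ {p} ps p∉ps =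
  cong length (filter-none (p ℕ.≟_) (All.tabulate λ { q∈ps refl → p∉ps q∈ps }))

-- Factorisations are unique up to order, so `ord` can be read off from whichever one is convenient;
-- multiplicativity below uses the concatenation of two factorisations.
ord-factors : ∀ p {n} .{{_ : ℕ.NonZero n}} (f : PrimeFactorisation n) →
  ord p n ≡ multiplicity p (factors f)
ord-factors p f = ↭-length (filter-↭ (p ℕ.≟_) (factorisationUnique (factorise _) f))

ord-cong : ∀ p {m n} → m ≡ n → .{{_ : ℕ.NonZero m}} .{{_ : ℕ.NonZero n}} → ord p m ≡ ord p n
ord-cong p refl = refl

ord-* : ∀ p m n .{{_ : ℕ.NonZero m}} .{{_ : ℕ.NonZero n}} .{{_ : ℕ.NonZero (m ℕ.* n)}} →
  ord p (m ℕ.* n) ≡ ord p m ℕ.+ ord p n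
ord-* p m n = begin
  ord p (m ℕ.* n)                              ≡⟨ ord-factors p fg ⟩
  multiplicity p (factors f ++ factors g)
    ≡⟨ cong length (filter-++ (p ℕ.≟_) (factors f) (factors g)) ⟩
  length (filter (p ℕ.≟_) (factors f) ++ filter (p ℕ.≟_) (factors g))
    ≡⟨ length-++ (filter (p ℕ.≟_) (factors f)) ⟩
  ord p m ℕ.+ ord p n                          ∎
  where
  open ≡-Reasoning
  f = factorise m
  g = factorise n
  fg : PrimeFactorisation (m ℕ.* n)
  fg = record
    { factors         = factors f ++ factors g
    ; isFactorisation = trans
        (cong₂ ℕ._*_ (PrimeFactorisation.isFactorisation f) (PrimeFactorisation.isFactorisation g))
        (sym (product-++ (factors f) (factors g)))
    ; factorsPrime    = All.++⁺ (PrimeFactorisation.factorsPrime f) (PrimeFactorisation.factorsPrime g)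
    }

ord-prime : ∀ {p} → Prime p → .{{_ : ℕ.NonZero p}} → ord p p ≡ 1
ord-prime {p} pr = trans (ord-factors p (primeFactorisation[p] pr))
  (cong length (filter-accept (p ℕ.≟_) {p} {[]} refl))

ord-≢ : ∀ {p q} → Prime p → q ≢ p → .{{_ : ℕ.NonZero p}} → ord q p ≡ 0
ord-≢ {p} {q} pr q≢p = trans (ord-factors q (primeFactorisation[p] pr))
  (cong length (filter-reject (q ℕ.≟_) {p} {[]} q≢p))

ord-^ : ∀ q p k .{{_ : ℕ.NonZero p}} .{{_ : ℕ.NonZero (p ^ k)}} → ord q (p ^ k) ≡ k ℕ.* ord q p
ord-^ q p zero    = refl
ord-^ q p (suc k) = trans (ord-* q p (p ^ k)) (cong (ord q p ℕ.+_) (ord-^ q p k))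
  where instance _ = ℕ.m^n≢0 p k

ord>0⇒∈factors : ∀ p n .{{_ : ℕ.NonZero n}} → 0 ℕ.< ord p n → p ∈ factors (factorise n)
ord>0⇒∈factors p n 0<o = decidable-stable (p ∈ℕ? factors (factorise n))
  λ p∉ → ℕ.<⇒≢ 0<o (sym (multiplicity-∉ (factors (factorise n)) p∉))

∣⇒ord>0 : ∀ {p} n .{{_ : ℕ.NonZero n}} → Prime p → p ∣ n → 0 ℕ.< ord p n
∣⇒ord>0 {p} n pr p∣n = multiplicity-∈ (factors (factorise n)) (factorisationHasAllPrimeFactors pr
  (subst (p ∣_) (PrimeFactorisation.isFactorisation (factorise n)) p∣n)
  (PrimeFactorisation.factorsPrime (factorise n)))

∤⇒ord≡0 : ∀ {p} n .{{_ : ℕ.NonZero n}} → ¬ p ∣ n → ord p n ≡ 0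
∤⇒ord≡0 {p} n p∤n = multiplicity-∉ (factors (factorise n)) λ p∈ → p∤n
  (subst (p ∣_) (sym (PrimeFactorisation.isFactorisation (factorise n))) (∈⇒∣product p∈))

ord>0⇒∣ : ∀ {p} n .{{_ : ℕ.NonZero n}} → 0 ℕ.< ord p n → p ∣ n
ord>0⇒∣ {p} n 0<ord = decidable-stable (p ℕ.∣? n) λ p∤n → ℕ.<⇒≢ 0<ord (sym (∤⇒ord≡0 n p∤n))

∈primeDivisors⁺ : ∀ {p} n .{{_ : ℕ.NonZero n}} → 0 ℕ.< ord p n → p ∈ primeDivisors n
∈primeDivisors⁺ {p} n 0<o = ∈-deduplicate⁺ ℕ._≟_ (ord>0⇒∈factors p n 0<o)

∈primeDivisors⁻ : ∀ {p} n .{{_ : ℕ.NonZero n}} → p ∈ primeDivisors n → 0 ℕ.< ord p n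
∈primeDivisors⁻ n p∈ =
  multiplicity-∈ (factors (factorise n)) (∈-deduplicate⁻ ℕ._≟_ (factors (factorise n)) p∈)

primeDivisors-unique : ∀ n .{{_ : ℕ.NonZero n}} → Unique (primeDivisors n)
primeDivisors-unique n = deduplicate-! (factors (factorise n))

-- Products of prime powers with prescribed exponents

∏^ : (ℕ → ℕ) → List ℕ → ℕ
∏^ e ps = product (map (λ p → p ^ e p) ps)

module _ (e : ℕ → ℕ) where

  ord-∏^-∉ : ∀ {q} ps → All Prime ps → q ∉ ps → .{{_ : ℕ.NonZero (∏^ e ps)}} →
    ord q (∏^ e ps) ≡ 0
  ord-∏^-∉ [] [] q∉ = refl
  ord-∏^-∉ {q} (p ∷ ps) (pr ∷ prs) q∉ = begin
    ord q (p ^ e p ℕ.* ∏^ e ps)            ≡⟨ ord-* q (p ^ e p) (∏^ e ps) ⟩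
    ord q (p ^ e p) ℕ.+ ord q (∏^ e ps)
      ≡⟨ cong₂ ℕ._+_ (ord-^ q p (e p)) (ord-∏^-∉ ps prs (q∉ ∘ there)) ⟩
    e p ℕ.* ord q p ℕ.+ 0                  ≡⟨ cong (λ z → e p ℕ.* z ℕ.+ 0) (ord-≢ pr (q∉ ∘ here)) ⟩
    e p ℕ.* 0 ℕ.+ 0                        ≡⟨ cong (ℕ._+ 0) (ℕ.*-zeroʳ (e p)) ⟩
    0                                      ∎
    where
    open ≡-Reasoning
    instance
      _ = prime⇒nonZero pr
      _ = ℕ.m*n≢0⇒m≢0 (p ^ e p) {∏^ e ps}
      _ = ℕ.m*n≢0⇒n≢0 (p ^ e p) {∏^ e ps}

  ord-∏^-∈ : ∀ {q} ps → All Prime ps → Unique ps → q ∈ ps → .{{_ : ℕ.NonZero (∏^ e ps)}} →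
    ord q (∏^ e ps) ≡ e q
  ord-∏^-∈ {q} (p ∷ ps) (pr ∷ prs) (p∉ ∷ u) q∈ = trans (ord-* q (p ^ e p) (∏^ e ps)) (split q∈)
    where
    open ≡-Reasoning
    instance
      _ = prime⇒nonZero pr
      _ = ℕ.m*n≢0⇒m≢0 (p ^ e p) {∏^ e ps}
      _ = ℕ.m*n≢0⇒n≢0 (p ^ e p) {∏^ e ps}
    split : q ∈ p ∷ ps → ord q (p ^ e p) ℕ.+ ord q (∏^ e ps) ≡ e q
    split (here refl) = begin
      ord p (p ^ e p) ℕ.+ ord p (∏^ e ps)  ≡⟨ cong₂ ℕ._+_ (ord-^ p p (e p))
                                                (ord-∏^-∉ ps prs λ p∈ → All.lookup p∉ p∈ refl) ⟩
      e p ℕ.* ord p p ℕ.+ 0                ≡⟨ ℕ.+-identityʳ _ ⟩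
      e p ℕ.* ord p p                      ≡⟨ cong (e p ℕ.*_) (ord-prime pr) ⟩
      e p ℕ.* 1                            ≡⟨ ℕ.*-identityʳ (e p) ⟩
      e p                                  ∎
    split (there q∈ps) = begin
      ord q (p ^ e p) ℕ.+ ord q (∏^ e ps)
        ≡⟨ cong₂ ℕ._+_ (ord-^ q p (e p)) (ord-∏^-∈ ps prs u q∈ps) ⟩
      e p ℕ.* ord q p ℕ.+ e q              ≡⟨ cong (λ z → e p ℕ.* z ℕ.+ e q)
                                                (ord-≢ pr λ { refl → All.lookup p∉ q∈ps refl }) ⟩
      e p ℕ.* 0 ℕ.+ e q                    ≡⟨ cong (ℕ._+ e q) (ℕ.*-zeroʳ (e p)) ⟩
      e q                                  ∎

-- Valuations and integrality of rational numbers

∣↥∣-* : ∀ x y →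
  ℤ.∣ ↥ (x * y) ∣ ℕ.* ℤ.∣ ℤ.gcd (↥ x ℤ.* ↥ y) (↧ x ℤ.* ↧ y) ∣ ≡ ℤ.∣ ↥ x ∣ ℕ.* ℤ.∣ ↥ y ∣
∣↥∣-* x y = trans (sym (ℤ.abs-* (↥ (x * y)) (ℤ.gcd (↥ x ℤ.* ↥ y) (↧ x ℤ.* ↧ y))))
  (trans (cong ℤ.∣_∣ (ℚ.↥-* x y)) (ℤ.abs-* (↥ x) (↥ y)))

↧ₙ-* : ∀ x y → ↧ₙ (x * y) ℕ.* ℤ.∣ ℤ.gcd (↥ x ℤ.* ↥ y) (↧ x ℤ.* ↧ y) ∣ ≡ ↧ₙ x ℕ.* ↧ₙ y
↧ₙ-* x y = trans (sym (ℤ.abs-* (↧ (x * y)) (ℤ.gcd (↥ x ℤ.* ↥ y) (↧ x ℤ.* ↧ y))))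
  (trans (cong ℤ.∣_∣ (ℚ.↧-* x y)) (ℤ.abs-* (↧ x) (↧ y)))

↧ₙ-+ : ∀ x y →
  ↧ₙ (x + y) ℕ.* ℤ.∣ ℤ.gcd (↥ x ℤ.* ↧ y ℤ.+ ↥ y ℤ.* ↧ x) (↧ x ℤ.* ↧ y) ∣ ≡ ↧ₙ x ℕ.* ↧ₙ y
↧ₙ-+ x y = trans (sym (ℤ.abs-* (↧ (x + y)) (ℤ.gcd (↥ x ℤ.* ↧ y ℤ.+ ↥ y ℤ.* ↧ x) (↧ x ℤ.* ↧ y))))
  (trans (cong ℤ.∣_∣ (ℚ.↧-+ x y)) (ℤ.abs-* (↧ x) (↧ y)))

∣↥∣≢0 : ∀ q .{{_ : ℚ.NonZero q}} → ℕ.NonZero ℤ.∣ ↥ q ∣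
∣↥∣≢0 q@record{} = ℕ.≢-nonZero (ℕ.≢-nonZero⁻¹ ℤ.∣ ↥ q ∣)

ordℚ-unfold : ∀ p q .{{_ : ℚ.NonZero q}} →
  ordℚ p q ≡ + ord p ℤ.∣ ↥ q ∣ {{∣↥∣≢0 q}} ℤ.- + ord p (↧ₙ q)
ordℚ-unfold p q@record{} = refl

-- Reducing the product fraction divides numerator and denominator by the same gcd `c`, whose
-- valuation `g` cancels in the difference.
ordℚ-* : ∀ p x y .{{_ : ℚ.NonZero x}} .{{_ : ℚ.NonZero y}} .{{_ : ℚ.NonZero (x * y)}} →
  ordℚ p (x * y) ≡ ordℚ p x ℤ.+ ordℚ p y
ordℚ-* p x@record{} y@record{} = begin
  ordℚ p (x * y)                               ≡⟨ ordℚ-unfold p (x * y) ⟩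
  + n ℤ.- + d
    ≡⟨ solve 3 (λ n d g → n :- d := (n :+ g) :- (d :+ g)) refl (+ n) (+ d) (+ g) ⟩
  + (n ℕ.+ g) ℤ.- + (d ℕ.+ g)                  ≡⟨ cong₂ (λ i j → + i ℤ.- + j) num den ⟩
  + (n₁ ℕ.+ n₂) ℤ.- + (d₁ ℕ.+ d₂)
    ≡⟨ solve 4 (λ a b c d → (a :+ b) :- (c :+ d) := (a :- c) :+ (b :- d)) refl (+ n₁) (+ n₂) (+ d₁) (+ d₂) ⟩
  (+ n₁ ℤ.- + d₁) ℤ.+ (+ n₂ ℤ.- + d₂)          ∎
  where
  open ≡-Reasoning
  open ℤ-Solver
  c = ℤ.∣ ℤ.gcd (↥ x ℤ.* ↥ y) (↧ x ℤ.* ↧ y) ∣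
  num′ = ∣↥∣-* x y
  den′ = ↧ₙ-* x y
  instance
    _ = ∣↥∣≢0 (x * y)
    _ : ℕ.NonZero (↧ₙ x ℕ.* ↧ₙ y)
    _ = ℕ.m*n≢0 (↧ₙ x) (↧ₙ y)
    _ : ℕ.NonZero (ℤ.∣ ↥ x ∣ ℕ.* ℤ.∣ ↥ y ∣)
    _ = ℕ.m*n≢0 ℤ.∣ ↥ x ∣ ℤ.∣ ↥ y ∣
    c≢0 : ℕ.NonZero c
    c≢0 = ℕ.m*n≢0⇒n≢0 (↧ₙ (x * y)) {{subst ℕ.NonZero (sym den′) (ℕ.m*n≢0 (↧ₙ x) (↧ₙ y))}}
    _ : ℕ.NonZero (↧ₙ (x * y) ℕ.* c)
    _ = ℕ.m*n≢0 (↧ₙ (x * y)) c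
    _ : ℕ.NonZero (ℤ.∣ ↥ (x * y) ∣ ℕ.* c)
    _ = ℕ.m*n≢0 ℤ.∣ ↥ (x * y) ∣ c
  n  = ord p ℤ.∣ ↥ (x * y) ∣
  d  = ord p (↧ₙ (x * y))
  g  = ord p c
  n₁ = ord p ℤ.∣ ↥ x ∣
  n₂ = ord p ℤ.∣ ↥ y ∣
  d₁ = ord p (↧ₙ x)
  d₂ = ord p (↧ₙ y)
  num : n ℕ.+ g ≡ n₁ ℕ.+ n₂
  num =
    trans (sym (ord-* p ℤ.∣ ↥ (x * y) ∣ c)) (trans (ord-cong p num′) (ord-* p ℤ.∣ ↥ x ∣ ℤ.∣ ↥ y ∣))
  den : d ℕ.+ g ≡ d₁ ℕ.+ d₂
  den = trans (sym (ord-* p (↧ₙ (x * y)) c)) (trans (ord-cong p den′) (ord-* p (↧ₙ x) (↧ₙ y)))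

ordℚ≥0 : ∀ {p} q .{{_ : ℚ.NonZero q}} → q IntegralAt p → ℤ.0ℤ ℤ.≤ ordℚ p q
ordℚ≥0 {p} q@record{} p∤d rewrite ∤⇒ord≡0 (↧ₙ q) p∤d =
  ℤ.≤-trans (ℤ.+≤+ ℕ.z≤n) (ℤ.≤-reflexive (sym (ℤ.+-identityʳ _)))

module _ {p : ℕ} (pr : Prime p) where

  private
    -- The reduced denominator of a sum or a product divides the product of the two denominators, so
    -- a prime dividing it would divide one of them.
    ∤-divisor : ∀ {d} c m n → d ℕ.* c ≡ m ℕ.* n → ¬ p ∣ m → ¬ p ∣ n → ¬ p ∣ d
    ∤-divisor c m n eq p∤m p∤n p∣d =
      [ p∤m , p∤n ] (euclidsLemma m n pr (subst (p ∣_) eq (ℕ.∣m⇒∣m*n c p∣d)))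

  integral-+ : ∀ x y → x IntegralAt p → y IntegralAt p → (x + y) IntegralAt p
  integral-+ x y = ∤-divisor _ (↧ₙ x) (↧ₙ y) (↧ₙ-+ x y)

  integral-* : ∀ x y → x IntegralAt p → y IntegralAt p → (x * y) IntegralAt p
  integral-* x y = ∤-divisor _ (↧ₙ x) (↧ₙ y) (↧ₙ-* x y)

  integral-neg : ∀ x → x IntegralAt p → (- x) IntegralAt p
  integral-neg x = subst (λ d → ¬ p ∣ d) (sym (cong ℤ.∣_∣ (ℚ.↧-neg x)))

  integral-- : ∀ x y → x IntegralAt p → y IntegralAt p → (x - y) IntegralAt p
  integral-- x y hx hy = integral-+ x (- y) hx (integral-neg y hy)

-- Minimality

-- Built with the constructor instead of `z / 1`, so that numerator and denominator are visible by
-- computation even when `z` is a variable.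
ι : ℤ → ℚ
ι z = ℚ.mkℚ z 0 (coprime-sym (1-coprimeTo ℤ.∣ z ∣))

ι-* : ∀ a b → ι a * ι b ≡ ι (a ℤ.* b)
ι-* a b = ℚ.toℚᵘ-injective (ℚᵘ.≃-trans (ℚ.toℚᵘ-homo-* (ι a) (ι b)) (ℚᵘ.*≡* refl))

ι-+ : ∀ a b → ι a + ι b ≡ ι (a ℤ.+ b)
ι-+ a b = ℚ.toℚᵘ-injective (ℚᵘ.≃-trans (ℚ.toℚᵘ-homo-+ (ι a) (ι b))
  (ℚᵘ.*≡* (cong (ℤ._* + 1) (cong₂ ℤ._+_ (ℤ.*-identityʳ a) (ℤ.*-identityʳ b)))))

ι-- : ∀ a b → ι a - ι b ≡ ι (a ℤ.- b)
ι-- a b = trans (cong (_+_ (ι a)) (neg b)) (ι-+ a (ℤ.- b))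
  where
  neg : ∀ b → - ι b ≡ ι (ℤ.- b)
  neg b = ℚ.toℚᵘ-injective (ℚ.toℚᵘ-homo‿- (ι b))

ordℚ-ι : ∀ p z .{{_ : ℤ.NonZero z}} → ordℚ p (ι z) ≡ + ord p ℤ.∣ z ∣
ordℚ-ι p z = ℤ.+-identityʳ _

ordℚ-cong : ∀ p {x y} → x ≡ y → .{{_ : ℚ.NonZero x}} .{{_ : ℚ.NonZero y}} → ordℚ p x ≡ ordℚ p y
ordℚ-cong p refl = refl

module _ {p : ℕ} (pr : Prime p) (E : EllipticCurve) (model : IsIntegralModelAt p E) where
  open EllipticCurve E
  open IsIntegralModelAt model

  private
    infixl 6 _⊕_ _⊖_
    infixl 7 _⊛_

    -- The wrapper lets Agda infer q, which it cannot recover from the denominator of q.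
    record Integral (q : ℚ) : Set where
      constructor int
      field integralAt : q IntegralAt p

    open Integral

    _⊕_ : ∀ {x y} → Integral x → Integral y → Integral (x + y)
    _⊕_ {x} {y} hx hy = int (integral-+ pr x y (integralAt hx) (integralAt hy))

    _⊖_ : ∀ {x y} → Integral x → Integral y → Integral (x - y)
    _⊖_ {x} {y} hx hy = int (integral-- pr x y (integralAt hx) (integralAt hy))

    _⊛_ : ∀ {x y} → Integral x → Integral y → Integral (x * y)
    _⊛_ {x} {y} hx hy = int (integral-* pr x y (integralAt hx) (integralAt hy))

    neg : ∀ {x} → Integral x → Integral (- x)
    neg {x} hx = int (integral-neg pr x (integralAt hx))

    constant : ∀ z → Integral (ι z)
    constant z = int λ p∣1 → ℕ.nonTrivial⇒≢1 {{prime⇒nonTrivial pr}} (ℕ.∣1⇒≡1 p∣1)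

    i₁ : Integral a₁
    i₁ = int a₁-integral
    i₂ : Integral a₂
    i₂ = int a₂-integral
    i₃ : Integral a₃
    i₃ = int a₃-integral
    i₄ : Integral a₄
    i₄ = int a₄-integral
    i₆ : Integral a₆
    i₆ = int a₆-integral
    j₂ : Integral b₂
    j₂ = i₁ ⊛ i₁ ⊕ constant (+ 4) ⊛ i₂
    j₄ : Integral b₄
    j₄ = constant (+ 2) ⊛ i₄ ⊕ i₁ ⊛ i₃
    j₆ : Integral b₆
    j₆ = i₃ ⊛ i₃ ⊕ constant (+ 4) ⊛ i₆
    j₈ : Integral b₈
    j₈ = i₁ ⊛ i₁ ⊛ i₆ ⊕ constant (+ 4) ⊛ i₂ ⊛ i₆ ⊖ i₁ ⊛ i₃ ⊛ i₄ ⊕ i₂ ⊛ i₃ ⊛ i₃ ⊖ i₄ ⊛ i₄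

  c₄-integral : c₄ E IntegralAt p
  c₄-integral = integralAt (j₂ ⊛ j₂ ⊖ constant (+ 24) ⊛ j₄)

  discriminant-integral : discriminant IntegralAt p
  discriminant-integral = integralAt
    (neg (j₂ ⊛ j₂ ⊛ j₈) ⊖ constant (+ 8) ⊛ j₄ ⊛ j₄ ⊛ j₄ ⊖ constant (+ 27) ⊛ j₆ ⊛ j₆
      ⊕ constant (+ 9) ⊛ j₂ ⊛ j₄ ⊛ j₆)

nonZero⇒≢0 : ∀ q .{{_ : ℚ.NonZero q}} → q ≢ 0ℚ
nonZero⇒≢0 q q≡0 = ℕ.≢-nonZero⁻¹ ℤ.∣ ↥ q ∣ {{∣↥∣≢0 q}} (cong (λ x → ℤ.∣ ↥ x ∣) q≡0)

x*y≢0⇒y≢0 : ∀ x y → .{{_ : ℚ.NonZero (x * y)}} → ℚ.NonZero y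
x*y≢0⇒y≢0 x y = ℚ.≢-nonZero {y} λ { refl → nonZero⇒≢0 (x * 0ℚ) (ℚ.*-zeroʳ x) }

x*y≢0 : ∀ x y → .{{_ : ℚ.NonZero x}} → .{{_ : ℚ.NonZero y}} → ℚ.NonZero (x * y)
x*y≢0 x y = ℚ.≢-nonZero {x * y} λ xy≡0 → nonZero⇒≢0 y (begin
  y                  ≡⟨ ℚ.*-identityˡ y ⟨
  1ℚ * y             ≡⟨ cong (_* y) (ℚ.*-inverseˡ x) ⟨
  (ℚ.1/ x) * x * y   ≡⟨ ℚ.*-assoc (ℚ.1/ x) x y ⟩
  (ℚ.1/ x) * (x * y) ≡⟨ cong (_*_ (ℚ.1/ x)) xy≡0 ⟩
  (ℚ.1/ x) * 0ℚ      ≡⟨ ℚ.*-zeroʳ (ℚ.1/ x) ⟩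
  0ℚ                 ∎)
  where open ≡-Reasoning

module _ (p : ℕ) {w c c′ d d′ : ℚ} (c≢0 : ℚ.NonZero c) (d≢0 : ℚ.NonZero d) (d′≢0 : ℚ.NonZero d′)
  (wc′≡c : w * c′ ≡ c) (www≡d : w * w * w * d′ ≡ d) where

  private
    wc′≢0 : ℚ.NonZero (w * c′)
    wc′≢0 = subst (λ x → ℚ.NonZero x) (sym wc′≡c) c≢0
    c′≢0 : ℚ.NonZero c′
    c′≢0 = x*y≢0⇒y≢0 w c′ {{wc′≢0}}
    w≢0 : ℚ.NonZero w
    w≢0 = x*y≢0⇒y≢0 c′ w {{subst (λ x → ℚ.NonZero x) (ℚ.*-comm w c′) wc′≢0}}
    ww≢0 : ℚ.NonZero (w * w)
    ww≢0 = x*y≢0 w w {{w≢0}} {{w≢0}}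
    www≢0 : ℚ.NonZero (w * w * w)
    www≢0 = x*y≢0 (w * w) w {{ww≢0}} {{w≢0}}
    v : ℤ
    v = ordℚ p w {{w≢0}}

  -- Write v for the valuation at `p`. From v(w) + v(c′) = v(c) = 0 and v(c′) ≥ 0 it follows that
  -- v(w) ≤ 0, hence v(d) = 3v(w) + v(d′) ≤ v(d′). In the application `w` is u⁴, with `c`, `c′` the
  -- values of `c₄` and `d`, `d′` the discriminants.
  ordℚ-scale : c′ IntegralAt p → ordℚ p c {{c≢0}} ≡ + 0 → ordℚ p d {{d≢0}} ℤ.≤ ordℚ p d′ {{d′≢0}}
  ordℚ-scale c′-integral ord-c = begin
    ordℚ p d {{d≢0}}
      ≡⟨ ordℚ-cong p www≡d {{wwwd′≢0}} {{d≢0}} ⟨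
    ordℚ p (w * w * w * d′) {{wwwd′≢0}}
      ≡⟨ ordℚ-* p (w * w * w) d′ {{www≢0}} {{d′≢0}} {{wwwd′≢0}} ⟩
    ordℚ p (w * w * w) {{www≢0}} ℤ.+ o
      ≡⟨ cong (ℤ._+ o) (ordℚ-* p (w * w) w {{ww≢0}} {{w≢0}} {{www≢0}}) ⟩
    ordℚ p (w * w) {{ww≢0}} ℤ.+ v ℤ.+ o
      ≡⟨ cong (λ z → z ℤ.+ v ℤ.+ o) (ordℚ-* p w w {{w≢0}} {{w≢0}} {{ww≢0}}) ⟩
    v ℤ.+ v ℤ.+ v ℤ.+ o
      ≤⟨ ℤ.+-monoˡ-≤ o (ℤ.+-mono-≤ (ℤ.+-mono-≤ v≤0 v≤0) v≤0) ⟩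
    + 0 ℤ.+ o
      ≡⟨ ℤ.+-identityˡ o ⟩
    o ∎
    where
    open ℤ.≤-Reasoning
    o = ordℚ p d′ {{d′≢0}}
    wwwd′≢0 : ℚ.NonZero (w * w * w * d′)
    wwwd′≢0 = x*y≢0 (w * w * w) d′ {{www≢0}} {{d′≢0}}
    v≤0 : v ℤ.≤ + 0
    v≤0 = begin
      v                              ≡⟨ ℤ.+-identityʳ v ⟨
      v ℤ.+ + 0                      ≤⟨ ℤ.+-monoʳ-≤ v (ordℚ≥0 c′ {{c′≢0}} c′-integral) ⟩
      v ℤ.+ ordℚ p c′ {{c′≢0}}       ≡⟨ ordℚ-* p w c′ {{w≢0}} {{c′≢0}} {{wc′≢0}} ⟨
      ordℚ p (w * c′) {{wc′≢0}}      ≡⟨ ordℚ-cong p wc′≡c {{wc′≢0}} {{c≢0}} ⟩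
      ordℚ p c {{c≢0}}               ≡⟨ ord-c ⟩
      + 0                            ∎

-- A change of variables scales c₄ by u⁻⁴ and the discriminant by u⁻¹², so a
-- p-integral model cannot lower the discriminant once c₄ is a p-unit.
c₄-unit⇒minimal : ∀ {p} → Prime p → ∀ E E′ → E ≅ E′ → IsIntegralModelAt p E′ →
  (c₄≢0 : ℚ.NonZero (c₄ E)) → ordℚ p (c₄ E) {{c₄≢0}} ≡ + 0 → ordΔ p E ℤ.≤ ordΔ p E′
c₄-unit⇒minimal {p} pr E E′ E≅E′ model c₄≢0 =
  ordℚ-scale p {u * u * u * u} {c₄ E} {c₄ E′} {discriminant E} {discriminant E′}
    c₄≢0 (discriminant≢0 E) (discriminant≢0 E′)
    (c₄-≅ E≅E′) (discriminant-≅ E≅E′) (c₄-integral pr E′ model)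
  where
  open EllipticCurve
  open _≅_ E≅E′ using (u)

-- The Frey curve

≅-refl : ∀ E → E ≅ E
≅-refl E = record
  { u = 1ℚ ; r = 0ℚ ; s = 0ℚ ; t = 0ℚ
  ; eq₁ = solve 1 (λ a₁ → k1 :* a₁ := a₁ :+ k2 :* k0) refl a₁
  ; eq₂ = solve 2 (λ a₁ a₂ → k1 :* k1 :* a₂ := a₂ :- k0 :* a₁ :+ k3 :* k0 :- k0 :* k0) refl a₁ a₂
  ; eq₃ = solve 2 (λ a₁ a₃ → k1 :* k1 :* k1 :* a₃ := a₃ :+ k0 :* a₁ :+ k2 :* k0) refl a₁ a₃
  ; eq₄ = solve 4 (λ a₁ a₂ a₃ a₄ → k1 :* k1 :* k1 :* k1 :* a₄ :=
      a₄ :- k0 :* a₃ :+ k2 :* k0 :* a₂ :- (k0 :+ k0 :* k0) :* a₁ :+ k3 :* k0 :* k0 :- k2 :* k0 :* k0)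
      refl a₁ a₂ a₃ a₄
  ; eq₆ = solve 5 (λ a₁ a₂ a₃ a₄ a₆ → k1 :* k1 :* k1 :* k1 :* k1 :* k1 :* a₆ :=
      a₆ :+ k0 :* a₄ :+ k0 :* k0 :* a₂ :+ k0 :* k0 :* k0 :- k0 :* a₃ :- k0 :* k0 :- k0 :* k0 :* a₁)
      refl a₁ a₂ a₃ a₄ a₆
  }
  where
  open EllipticCurve E
  open +-*-Solver
  k0 k1 k2 k3 : ∀ {n} → Polynomial n
  k0 = con 0ℚ
  k1 = con 1ℚ
  k2 = con (+ 2 / 1)
  k3 = con (+ 3 / 1)

-- y² = x³ + αx² + βx
twoTorsionEquation : ℤ → ℤ → WeierstrassEquation
twoTorsionEquation α β = record { a₁ = 0ℚ ; a₂ = ι α ; a₃ = 0ℚ ; a₄ = ι β ; a₆ = 0ℚ }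

twoTorsion-discriminant : ∀ α β → WeierstrassEquation.discriminant (twoTorsionEquation α β) ≡
  ι (+ 16 ℤ.* (β ℤ.* β) ℤ.* (α ℤ.* α ℤ.- + 4 ℤ.* β))
twoTorsion-discriminant α β = begin
  WeierstrassEquation.discriminant (twoTorsionEquation α β)
    ≡⟨ solve 2 (λ a₂ a₄ →
         let a₁ = con 0ℚ ; a₃ = con 0ℚ ; a₆ = con 0ℚ
             b₂ = a₁ :* a₁ :+ con (+ 4 / 1) :* a₂
             b₄ = con (+ 2 / 1) :* a₄ :+ a₁ :* a₃
             b₆ = a₃ :* a₃ :+ con (+ 4 / 1) :* a₆
             b₈ = a₁ :* a₁ :* a₆ :+ con (+ 4 / 1) :* a₂ :* a₆ :- a₁ :* a₃ :* a₄
                    :+ a₂ :* a₃ :* a₃ :- a₄ :* a₄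
         in :- (b₂ :* b₂ :* b₈) :- con (+ 8 / 1) :* b₄ :* b₄ :* b₄ :- con (+ 27 / 1) :* b₆ :* b₆
              :+ con (+ 9 / 1) :* b₂ :* b₄ :* b₆
            := con (+ 16 / 1) :* (a₄ :* a₄) :* (a₂ :* a₂ :- con (+ 4 / 1) :* a₄)) refl (ι α) (ι β) ⟩
  ι (+ 16) * (ι β * ι β) * (ι α * ι α - ι (+ 4) * ι β)
    ≡⟨ cong₂ _*_ (trans (cong (_*_ (ι (+ 16))) (ι-* β β)) (ι-* (+ 16) (β ℤ.* β)))
                 (trans (cong₂ _-_ (ι-* α α) (ι-* (+ 4) β)) (ι-- (α ℤ.* α) (+ 4 ℤ.* β))) ⟩
  ι (+ 16 ℤ.* (β ℤ.* β)) * ι (α ℤ.* α ℤ.- + 4 ℤ.* β)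
    ≡⟨ ι-* (+ 16 ℤ.* (β ℤ.* β)) (α ℤ.* α ℤ.- + 4 ℤ.* β) ⟩
  ι (+ 16 ℤ.* (β ℤ.* β) ℤ.* (α ℤ.* α ℤ.- + 4 ℤ.* β)) ∎
  where
  open ≡-Reasoning
  open +-*-Solver

module Frey (A B C : ℤ) .{{_ : ℤ.NonZero A}} .{{_ : ℤ.NonZero B}} .{{_ : ℤ.NonZero C}}
  (sum≡0 : A ℤ.+ B ℤ.+ C ≡ + 0) (gcd≡1 : ℤ.gcd (ℤ.gcd A B) C ≡ + 1) where

  C≡ : C ≡ ℤ.- (A ℤ.+ B)
  C≡ = begin
    C
      ≡⟨ solve 3 (λ a b c → c := :- (a :+ b) :+ (a :+ b :+ c)) refl A B C ⟩
    ℤ.- (A ℤ.+ B) ℤ.+ (A ℤ.+ B ℤ.+ C) ≡⟨ cong (ℤ._+_ (ℤ.- (A ℤ.+ B))) sum≡0 ⟩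
    ℤ.- (A ℤ.+ B) ℤ.+ + 0           ≡⟨ ℤ.+-identityʳ _ ⟩
    ℤ.- (A ℤ.+ B)                   ∎
    where
    open ≡-Reasoning
    open ℤ-Solver

  ABC Δ Q : ℤ
  ABC = A ℤ.* B ℤ.* C
  Δ = + 16 ℤ.* (ABC ℤ.* ABC)
  Q = A ℤ.* A ℤ.+ A ℤ.* B ℤ.+ B ℤ.* B

  instance
    ABC≢0 : ℤ.NonZero ABC
    ABC≢0 = ℤ.i*j≢0 (A ℤ.* B) C {{ℤ.i*j≢0 A B}}
    Δ≢0 : ℤ.NonZero Δ
    Δ≢0 = ℤ.i*j≢0 (+ 16) (ABC ℤ.* ABC) {{_}} {{ℤ.i*j≢0 ABC ABC}}

  -- y² = x(x - A)(x + B)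
  equation : WeierstrassEquation
  equation = twoTorsionEquation (B ℤ.- A) (ℤ.- (A ℤ.* B))

  -- With α = B - A and β = -AB, the factor α² - 4β is (B - A)² + 4AB = (A + B)² = C².
  discriminant≡ : WeierstrassEquation.discriminant equation ≡ ι Δ
  discriminant≡ = trans (twoTorsion-discriminant (B ℤ.- A) (ℤ.- (A ℤ.* B))) (cong ι (begin
    + 16 ℤ.* (β ℤ.* β) ℤ.* (α ℤ.* α ℤ.- + 4 ℤ.* β)
      ≡⟨ solve 2 (λ a b → con (+ 16) :* ((:- (a :* b)) :* (:- (a :* b)))
             :* ((b :- a) :* (b :- a) :- con (+ 4) :* (:- (a :* b)))
           := con (+ 16) :* ((a :* b :* (:- (a :+ b))) :* (a :* b :* (:- (a :+ b))))) refl A B ⟩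
    + 16 ℤ.* (A ℤ.* B ℤ.* (ℤ.- (A ℤ.+ B)) ℤ.* (A ℤ.* B ℤ.* (ℤ.- (A ℤ.+ B))))
      ≡⟨ cong (λ c → + 16 ℤ.* (A ℤ.* B ℤ.* c ℤ.* (A ℤ.* B ℤ.* c))) C≡ ⟨
    Δ ∎))
    where
    open ≡-Reasoning
    open ℤ-Solver
    α = B ℤ.- A
    β = ℤ.- (A ℤ.* B)

  curve : EllipticCurve
  curve =
    record { equation = equation ; discriminant≢0 = subst (λ x → ℚ.NonZero x) (sym discriminant≡) Δ≢0 }

  c₄≡ : c₄ curve ≡ ι (+ 16 ℤ.* Q)
  c₄≡ = begin
    c₄ curve
      ≡⟨ solve 2 (λ a₂ a₄ → (con 0ℚ :* con 0ℚ :+ con (+ 4 / 1) :* a₂) :* (con 0ℚ :* con 0ℚ :+ con (+ 4 / 1) :* a₂)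
             :- con (+ 24 / 1) :* (con (+ 2 / 1) :* a₄ :+ con 0ℚ :* con 0ℚ)
           := con (+ 16 / 1) :* (a₂ :* a₂ :- con (+ 3 / 1) :* a₄)) refl (ι α) (ι β) ⟩
    ι (+ 16) * (ι α * ι α - ι (+ 3) * ι β)
      ≡⟨ cong (_*_ (ι (+ 16))) (trans (cong₂ _-_ (ι-* α α) (ι-* (+ 3) β)) (ι-- (α ℤ.* α) (+ 3 ℤ.* β))) ⟩
    ι (+ 16) * ι (α ℤ.* α ℤ.- + 3 ℤ.* β)
      ≡⟨ ι-* (+ 16) (α ℤ.* α ℤ.- + 3 ℤ.* β) ⟩
    ι (+ 16 ℤ.* (α ℤ.* α ℤ.- + 3 ℤ.* β))
      ≡⟨ cong (λ z → ι (+ 16 ℤ.* z)) (quadratic A B) ⟩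
    ι (+ 16 ℤ.* Q) ∎
    where
    open ≡-Reasoning
    open +-*-Solver
    α = B ℤ.- A
    β = ℤ.- (A ℤ.* B)
    quadratic : ∀ a b →
      (b ℤ.- a) ℤ.* (b ℤ.- a) ℤ.- + 3 ℤ.* (ℤ.- (a ℤ.* b)) ≡ a ℤ.* a ℤ.+ a ℤ.* b ℤ.+ b ℤ.* b
    quadratic = ℤ-Solver.solve 2 (λ a b → (b ℤ-Solver.:- a) ℤ-Solver.:* (b ℤ-Solver.:- a)
        ℤ-Solver.:- ℤ-Solver.con (+ 3) ℤ-Solver.:* (ℤ-Solver.:- (a ℤ-Solver.:* b))
      ℤ-Solver.:= a ℤ-Solver.:* a ℤ-Solver.:+ a ℤ-Solver.:* b ℤ-Solver.:+ b ℤ-Solver.:* b) refl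

  integralModel : ∀ {p} → Prime p → IsIntegralModelAt p curve
  integralModel {p} pr = record
    { a₁-integral = p∤1 ; a₂-integral = p∤1 ; a₃-integral = p∤1 ; a₄-integral = p∤1 ; a₆-integral = p∤1 }
    where
    p∤1 : ¬ p ∣ 1
    p∤1 p∣1 = ℕ.nonTrivial⇒≢1 {{prime⇒nonTrivial pr}} (ℕ.∣1⇒≡1 p∣1)

  ordΔ-curve : ∀ p → ordΔ p curve ≡ + ord p ℤ.∣ Δ ∣
  ordΔ-curve p =
    trans (ordℚ-cong p discriminant≡ {{EllipticCurve.discriminant≢0 curve}} {{Δ≢0}}) (ordℚ-ι p Δ)

  module _ {p : ℕ} (pr : Prime p) (p≢2 : p ≢ 2) where

    private
      P = + p

      p∤16 : ¬ p ∣ 16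
      p∤16 p∣16 = p≢2 (lemma 4 p∣16)
        where
        lemma : ∀ k → p ∣ 2 ^ k → p ≡ 2
        lemma zero    p∣1 = contradiction (ℕ.∣1⇒≡1 p∣1) (ℕ.nonTrivial⇒≢1 {{prime⇒nonTrivial pr}})
        lemma (suc k) p∣2^ with euclidsLemma 2 (2 ^ k) pr p∣2^
        ... | inj₂ p∣2^k = lemma k p∣2^k
        ... | inj₁ p∣2 with prime⇒irreducible prime[2] p∣2
        ...   | inj₁ p≡1 = contradiction p≡1 (ℕ.nonTrivial⇒≢1 {{prime⇒nonTrivial pr}})
        ...   | inj₂ p≡2 = p≡2

      euclid : ∀ i j → P ℤₛ.∣ i ℤ.* j → P ℤₛ.∣ i ⊎ P ℤₛ.∣ j
      euclid i j P∣ij with euclidsLemma ℤ.∣ i ∣ ℤ.∣ j ∣ pr (subst (p ∣_) (ℤ.abs-* i j) (ℤₛ.∣⇒∣ᵤ P∣ij))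
      ... | inj₁ p∣i = inj₁ (ℤₛ.∣ᵤ⇒∣ p∣i)
      ... | inj₂ p∣j = inj₂ (ℤₛ.∣ᵤ⇒∣ p∣j)

      square : ∀ i → P ℤₛ.∣ i ℤ.* i → P ℤₛ.∣ i
      square i P∣ii = [ (λ h → h) , (λ h → h) ] (euclid i i P∣ii)

      -- Since C = -(A + B), a common prime of `A` and `B` divides all three numbers. This is where
      -- coprimality enters.
      notBoth : P ℤₛ.∣ A → ¬ P ℤₛ.∣ B
      notBoth P∣A P∣B =
        ℕ.nonTrivial⇒≢1 {{prime⇒nonTrivial pr}} (ℕ.∣1⇒≡1 (subst (λ z → p ∣ ℤ.∣ z ∣) gcd≡1
        (ℤ.gcd-greatest {ℤ.gcd A B} {C} {P} (ℤ.gcd-greatest {A} {B} {P} (ℤₛ.∣⇒∣ᵤ P∣A) (ℤₛ.∣⇒∣ᵤ P∣B))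
          (ℤₛ.∣⇒∣ᵤ P∣C))))
        where
        P∣C : P ℤₛ.∣ C
        P∣C = subst (P ℤₛ.∣_) (sym C≡) (ℤₛ.∣m⇒∣-m (ℤₛ.∣m∣n⇒∣m+n P∣A P∣B))

      open ℤ-Solver

      -- Modulo `A`, `B` and `C` the form `Q` is congruent to B², A² and -AB respectively, so a
      -- prime dividing `Q` and one of the three would divide both `A` and `B`.
      A∤Q : P ℤₛ.∣ A → ¬ P ℤₛ.∣ Q
      A∤Q P∣A P∣Q = notBoth P∣A (square B (subst (P ℤₛ.∣_)
        (solve 2 (λ a b → (a :* a :+ a :* b :+ b :* b) :- (a :+ b) :* a := b :* b) refl A B)
        (ℤₛ.∣m∣n⇒∣m-n P∣Q (ℤₛ.∣n⇒∣m*n (A ℤ.+ B) P∣A))))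

      B∤Q : P ℤₛ.∣ B → ¬ P ℤₛ.∣ Q
      B∤Q P∣B P∣Q = A∤Q (square A (subst (P ℤₛ.∣_)
        (solve 2 (λ a b → (a :* a :+ a :* b :+ b :* b) :- (a :+ b) :* b := a :* a) refl A B)
        (ℤₛ.∣m∣n⇒∣m-n P∣Q (ℤₛ.∣n⇒∣m*n (A ℤ.+ B) P∣B)))) P∣Q

      C∤Q : P ℤₛ.∣ C → ¬ P ℤₛ.∣ Q
      C∤Q P∣C P∣Q = [ (λ P∣A → A∤Q P∣A P∣Q) , (λ P∣B → B∤Q P∣B P∣Q) ] (euclid A B (subst (P ℤₛ.∣_)
        (solve 2 (λ a b → (a :+ b) :* (a :+ b) :- (a :* a :+ a :* b :+ b :* b) := a :* b) refl A B)
        (ℤₛ.∣m∣n⇒∣m-n (ℤₛ.∣n⇒∣m*n (A ℤ.+ B) P∣A+B) P∣Q)))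
        where
        P∣A+B : P ℤₛ.∣ A ℤ.+ B
        P∣A+B = subst (P ℤₛ.∣_) (trans (cong ℤ.-_ C≡) (ℤ.neg-involutive (A ℤ.+ B))) (ℤₛ.∣m⇒∣-m P∣C)

    ∣ABC⇒∤Q : p ∣ ℤ.∣ ABC ∣ → ¬ p ∣ ℤ.∣ Q ∣
    ∣ABC⇒∤Q p∣ABC p∣Q with euclid (A ℤ.* B) C (ℤₛ.∣ᵤ⇒∣ p∣ABC)
    ... | inj₂ P∣C = C∤Q P∣C (ℤₛ.∣ᵤ⇒∣ p∣Q)
    ... | inj₁ P∣AB with euclid A B P∣AB
    ...   | inj₁ P∣A = A∤Q P∣A (ℤₛ.∣ᵤ⇒∣ p∣Q)
    ...   | inj₂ P∣B = B∤Q P∣B (ℤₛ.∣ᵤ⇒∣ p∣Q)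

    ∣16*⇒∣ : ∀ z → p ∣ ℤ.∣ + 16 ℤ.* z ∣ → p ∣ ℤ.∣ z ∣
    ∣16*⇒∣ z p∣16z with euclidsLemma 16 ℤ.∣ z ∣ pr (subst (p ∣_) (ℤ.abs-* (+ 16) z) p∣16z)
    ... | inj₁ p∣16 = contradiction p∣16 p∤16
    ... | inj₂ p∣z  = p∣z

    ∣Δ⇒∣ABC : p ∣ ℤ.∣ Δ ∣ → p ∣ ℤ.∣ ABC ∣
    ∣Δ⇒∣ABC p∣Δ = ℤₛ.∣⇒∣ᵤ (square ABC (ℤₛ.∣ᵤ⇒∣ (∣16*⇒∣ (ABC ℤ.* ABC) p∣Δ)))

    -- If `p` does not divide `Δ`, the valuation is 0 and integrality of the other discriminant
    -- suffices. Otherwise `p` divides `ABC`, hence not 16Q, and the c₄ criterion applies.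
    minimal : ∀ E → curve ≅ E → IsIntegralModelAt p E → + ord p ℤ.∣ Δ ∣ ℤ.≤ ordΔ p E
    minimal E iso model with p ℕ.∣? ℤ.∣ Δ ∣
    ... | no p∤Δ = ℤ.≤-trans (ℤ.≤-reflexive (cong +_ (∤⇒ord≡0 ℤ.∣ Δ ∣ p∤Δ)))
      (ordℚ≥0 (EllipticCurve.discriminant E) {{EllipticCurve.discriminant≢0 E}} (discriminant-integral pr E model))
    ... | yes p∣Δ = subst (ℤ._≤ ordΔ p E) (ordΔ-curve p) (c₄-unit⇒minimal pr curve E iso model c₄≢0
      (trans (ordℚ-cong p c₄≡ {{c₄≢0}} {{16Q≢0}}) (trans (ordℚ-ι p (+ 16 ℤ.* Q) {{16Q≢0}})
        (cong +_ (∤⇒ord≡0 ℤ.∣ + 16 ℤ.* Q ∣ {{16Q≢0}} p∤16Q)))))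
      where
      p∤16Q : ¬ p ∣ ℤ.∣ + 16 ℤ.* Q ∣
      p∤16Q p∣16Q = ∣ABC⇒∤Q (∣Δ⇒∣ABC p∣Δ) (∣16*⇒∣ Q p∣16Q)
      -- Nonvanishing of c₄ comes from the same divisibility: `p` divides 0 but not 16Q.
      16Q≢0 : ℤ.NonZero (+ 16 ℤ.* Q)
      16Q≢0 = ℕ.≢-nonZero λ eq → p∤16Q (subst (p ∣_) (sym eq) (p ℕ.∣0))
      c₄≢0 : ℚ.NonZero (c₄ curve)
      c₄≢0 = subst (λ x → ℚ.NonZero x) (sym c₄≡) 16Q≢0

-- `P` is not assumed decidable, hence the double negation. If there were no least element, strong
-- induction would show that no `n` satisfies `P`.
least : ∀ {P : ℕ → Set} → ∃ P → ¬ ¬ (∃ λ m → P m × ∀ k → P k → m ℕ.≤ k)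
least {P} (n , Pn) ¬least = <-rec (λ n → ¬ P n) step n Pn
  where
  step : ∀ n → (∀ {k} → k ℕ.< n → ¬ P k) → ¬ P n
  step n rec Pn = ¬least (n , Pn , λ k Pk → ℕ.≮⇒≥ λ k<n → rec k<n Pk)

-- The minimal discriminant of the Frey curve

module _ (A B C : ℤ) .{{_ : ℤ.NonZero A}} .{{_ : ℤ.NonZero B}} .{{_ : ℤ.NonZero C}}
  (sum≡0 : A ℤ.+ B ℤ.+ C ≡ + 0) (gcd≡1 : ℤ.gcd (ℤ.gcd A B) C ≡ + 1) where

  open Frey A B C sum≡0 gcd≡1

  -- All that the depletion argument needs to know about `D`. The exponents are compared at odd
  -- primes only: at 2 a change of variables can lower the discriminant, possibly until 2 no longer
  -- divides it.
  record FreyDiscriminant : Set where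
    field
      D             : ℤ
      D≢0           : ℤ.NonZero D
      isMinimal     : IsMinimalDiscriminant curve D {{D≢0}}
      ord-ABC≤ord-D : ∀ p → Prime p → p ≢ 2 → ord p ℤ.∣ ABC ∣ ℕ.≤ ord p ℤ.∣ D ∣ {{D≢0}}
      ord-ABC>0     : ∀ p → Prime p → p ≢ 2 → 0 ℕ.< ord p ℤ.∣ D ∣ {{D≢0}} → 0 ℕ.< ord p ℤ.∣ ABC ∣

  private
    HasModel : ℕ → ℕ → Set
    HasModel p m = ∃ λ E → curve ≅ E × IsIntegralModelAt p E × ordΔ p E ≡ + m

    N = ℤ.∣ Δ ∣

    hasModel : ∀ {p} → Prime p → HasModel p (ord p N)
    hasModel {p} pr = curve , ≅-refl curve , integralModel pr , ordΔ-curve p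

    module _ (m : ℕ) (model : HasModel 2 m) (least : ∀ k → HasModel 2 k → m ℕ.≤ k) where

      exponent : ℕ → ℕ
      exponent p with p ℕ.≟ 2
      ... | yes _ = m
      ... | no  _ = ord p N

      exponent-≢2 : ∀ {p} → p ≢ 2 → exponent p ≡ ord p N
      exponent-≢2 {p} p≢2 with p ℕ.≟ 2
      ... | yes p≡2 = contradiction p≡2 p≢2
      ... | no  _   = refl

      -- This is `N` with its exponent at 2 replaced by the least possible one, `m`.
      D₀ : ℕ
      D₀ = ∏^ exponent (primeDivisors N)

      D₀≢0 : ℕ.NonZero D₀
      D₀≢0 = product≢0 (All.map⁺ (All.map
        (λ {p} pr → ℕ.m^n≢0 p (exponent p) {{prime⇒nonZero pr}}) (primeDivisors-prime N)))

      ord-D₀ : ∀ {p} → p ≢ 2 → ord p D₀ {{D₀≢0}} ≡ ord p N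
      ord-D₀ {p} p≢2 with p ∈ℕ? primeDivisors N
      ... | yes p∈ = trans
        (ord-∏^-∈ exponent _ (primeDivisors-prime N) (primeDivisors-unique N) p∈ {{D₀≢0}})
        (exponent-≢2 p≢2)
      ... | no  p∉ = trans (ord-∏^-∉ exponent _ (primeDivisors-prime N) p∉ {{D₀≢0}})
        (sym (ℕ.n≤0⇒n≡0 (ℕ.≮⇒≥ λ 0<ord → p∉ (∈primeDivisors⁺ N 0<ord))))

      -- The factor 16 of `Δ` guarantees that 2 occurs among the primes of the product, so its
      -- exponent is the prescribed `m`, even when `m` is 0.
      ord₂-D₀ : ord 2 D₀ {{D₀≢0}} ≡ m
      ord₂-D₀ = ord-∏^-∈ exponent _ (primeDivisors-prime N) (primeDivisors-unique N)
        (∈primeDivisors⁺ N (∣⇒ord>0 N prime[2]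
          (ℕ.∣-trans (ℕ.divides 8 refl) (subst (16 ∣_) (sym (ℤ.abs-* (+ 16) (ABC ℤ.* ABC)))
            (ℕ.m∣m*n {16} ℤ.∣ ABC ℤ.* ABC ∣)))))
        {{D₀≢0}}

      -- `m` is least among natural numbers, whereas `ordΔ` is an integer; integrality of the
      -- discriminant rules out negative values.
      ord-≥ : ∀ E → curve ≅ E → IsIntegralModelAt 2 E → + m ℤ.≤ ordΔ 2 E
      ord-≥ E iso integral = go (ordΔ 2 E) refl
        (ordℚ≥0 (EllipticCurve.discriminant E) {{EllipticCurve.discriminant≢0 E}}
          (discriminant-integral prime[2] E integral))
        where
        go : ∀ z → ordΔ 2 E ≡ z → + 0 ℤ.≤ z → + m ℤ.≤ z
        go (+ k) eq _ = ℤ.+≤+ (least k (E , iso , integral , eq))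

      isMinimal₀ : IsMinimalDiscriminant curve (+ D₀) {{D₀≢0}}
      isMinimal₀ p pr with p ℕ.≟ 2
      ... | no p≢2 = subst (HasModel p) (sym (ord-D₀ p≢2)) (hasModel pr) ,
        λ E iso integral → subst (λ k → + k ℤ.≤ ordΔ p E) (sym (ord-D₀ p≢2)) (minimal pr p≢2 E iso integral)
      ... | yes refl = subst (HasModel 2) (sym ord₂-D₀) model ,
        λ E iso integral → subst (λ k → + k ℤ.≤ ordΔ 2 E) (sym ord₂-D₀) (ord-≥ E iso integral)

      ord-ABC≤ord-Δ : ∀ p → ord p ℤ.∣ ABC ∣ ℕ.≤ ord p N
      ord-ABC≤ord-Δ p = subst (ord p X ℕ.≤_) (sym eq)
        (ℕ.≤-trans (ℕ.m≤m+n (ord p X) (ord p X)) (ℕ.m≤n+m (ord p X ℕ.+ ord p X) (ord p 16)))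
        where
        X = ℤ.∣ ABC ∣
        instance
          _ : ℕ.NonZero (X ℕ.* X)
          _ = ℕ.m*n≢0 X X
          _ : ℕ.NonZero (16 ℕ.* (X ℕ.* X))
          _ = ℕ.m*n≢0 16 (X ℕ.* X)
        eq : ord p N ≡ ord p 16 ℕ.+ (ord p X ℕ.+ ord p X)
        eq =
          trans (ord-cong p (trans (ℤ.abs-* (+ 16) (ABC ℤ.* ABC)) (cong (16 ℕ.*_) (ℤ.abs-* ABC ABC))))
          (trans (ord-* p 16 (X ℕ.* X)) (cong (ord p 16 ℕ.+_) (ord-* p X X)))

      freyDiscriminant₀ : FreyDiscriminant
      freyDiscriminant₀ = record
        { D             = + D₀
        ; D≢0           = D₀≢0
        ; isMinimal     = isMinimal₀
        ; ord-ABC≤ord-D = λ p pr p≢2 → subst (ord p ℤ.∣ ABC ∣ ℕ.≤_) (sym (ord-D₀ p≢2)) (ord-ABC≤ord-Δ p)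
        ; ord-ABC>0     = λ p pr p≢2 0<ord → ∣⇒ord>0 ℤ.∣ ABC ∣ pr (∣Δ⇒∣ABC pr p≢2
            (ord>0⇒∣ N (subst (0 ℕ.<_) (ord-D₀ p≢2) 0<ord)))
        }

  -- Only the exponent of 2 in the minimal discriminant is out of reach of the
  -- c₄ criterion; it is the least discriminant valuation among all 2-integral
  -- models, which exists up to double negation.
  freyDiscriminant : ¬ ¬ FreyDiscriminant
  freyDiscriminant ¬d = least {HasModel 2} (ord 2 N , hasModel prime[2])
    λ (m , model , min) → ¬d (freyDiscriminant₀ m model min)

-- Depletion

private variable
  X : Set

select : (xs : List X) → Subset (length xs) → List X
select []       []            = []
select (x ∷ xs) (inside ∷ I)  = x ∷ select xs I
select (x ∷ xs) (outside ∷ I) = select xs I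

filter-∈?-suc : ∀ {n} b (I : Subset n) js →
  filter (_∈? (b ∷ I)) (map suc js) ≡ map suc (filter (_∈? I) js)
filter-∈?-suc b I []       = refl
filter-∈?-suc b I (j ∷ js) with does (j ∈? I)
... | true  = cong (suc j ∷_) (filter-∈?-suc b I js)
... | false = filter-∈?-suc b I js

-- Subproducts are indexed by positions in the prime list of one particular integer. Passing to
-- lists of primes lets the subsets belonging to two different integers be compared.
map-lookup-filter : (xs : List X) (I : Subset (length xs)) →
  map (lookup xs) (filter (_∈? I) (allFin (length xs))) ≡ select xs I
map-lookup-filter []       []      = refl
map-lookup-filter (x ∷ xs) (b ∷ I) = head b
  where
  tail : ∀ b → map (lookup (x ∷ xs)) (filter (_∈? (b ∷ I)) (tabulate suc)) ≡ select xs I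
  tail b = begin
    map (lookup (x ∷ xs)) (filter (_∈? (b ∷ I)) (tabulate suc))
      ≡⟨ cong (λ js → map (lookup (x ∷ xs)) (filter (_∈? (b ∷ I)) js)) (map-tabulate (λ i → i) suc) ⟨
    map (lookup (x ∷ xs)) (filter (_∈? (b ∷ I)) (map suc (allFin (length xs))))
      ≡⟨ cong (map (lookup (x ∷ xs))) (filter-∈?-suc b I (allFin (length xs))) ⟩
    map (lookup (x ∷ xs)) (map suc (filter (_∈? I) (allFin (length xs))))
      ≡⟨ map-∘ (filter (_∈? I) (allFin (length xs))) ⟨
    map (lookup xs) (filter (_∈? I) (allFin (length xs)))
      ≡⟨ map-lookup-filter xs I ⟩
    select xs I ∎
    where open ≡-Reasoning
  head : ∀ b →
    map (lookup (x ∷ xs)) (filter (_∈? (b ∷ I)) (allFin (suc (length xs)))) ≡ select (x ∷ xs) (b ∷ I)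
  head inside  = cong (x ∷_) (tail inside)
  head outside = tail outside

length-select : (xs : List X) (I : Subset (length xs)) → length (select xs I) ≡ Subset.∣ I ∣
length-select []       []            = refl
length-select (x ∷ xs) (inside ∷ I)  = cong suc (length-select xs I)
length-select (x ∷ xs) (outside ∷ I) = length-select xs I

All-select : ∀ {P : Pred X 0ℓ} (xs : List X) I → All P xs → All P (select xs I)
All-select []       []            []         = []
All-select (x ∷ xs) (inside ∷ I)  (px ∷ pxs) = px ∷ All-select xs I pxs
All-select (x ∷ xs) (outside ∷ I) (px ∷ pxs) = All-select xs I pxs

Unique-select : (xs : List X) (I : Subset (length xs)) → Unique xs → Unique (select xs I)
Unique-select []       []            []       = []
Unique-select (x ∷ xs) (inside ∷ I)  (x∉ ∷ u) = All-select xs I x∉ ∷ Unique-select xs I u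
Unique-select (x ∷ xs) (outside ∷ I) (x∉ ∷ u) = Unique-select xs I u

filter-as-select : ∀ {P : Pred X 0ℓ} (P? : Decidable P) xs → ∃ λ I → select xs I ≡ filter P? xs
filter-as-select P? []       = [] , refl
filter-as-select P? (x ∷ xs) with does (P? x) | filter-as-select P? xs
... | true  | I , eq = inside ∷ I , cong (x ∷_) eq
... | false | I , eq = outside ∷ I , eq

∈-subsets : ∀ {n} (I : Subset n) → I ∈ subsets n
∈-subsets []            = here refl
∈-subsets (inside ∷ I)  = ∈-++⁺ʳ _ (∈-map⁺ (inside ∷_) (∈-subsets I))
∈-subsets (outside ∷ I) = ∈-++⁺ˡ (∈-map⁺ (outside ∷_) (∈-subsets I))

Unique-⊆⇒↭ : ∀ {xs ys : List X} → Unique xs → Unique ys → xs ⊆ ys → ys ⊆ xs → xs ↭ ys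
Unique-⊆⇒↭ ux uy xs⊆ys ys⊆xs = ∼bag⇒↭ (unique∧set⇒bag ux uy (mk⇔ xs⊆ys ys⊆xs))

-- Pigeonhole: one copy of `x` is cut out of the larger list, and uniqueness keeps the other entries
-- of the smaller list away from the gap.
Unique-⊆⇒length≤ : ∀ {xs ys : List X} → Unique xs → xs ⊆ ys → length xs ℕ.≤ length ys
Unique-⊆⇒length≤ {xs = []}     _        _    = ℕ.z≤n
Unique-⊆⇒length≤ {xs = x ∷ xs} (x∉ ∷ u) x∷xs⊆ with as , bs , refl ← ∈-∃++ (x∷xs⊆ (here refl)) = begin
  suc (length xs)               ≤⟨ ℕ.s≤s (Unique-⊆⇒length≤ u xs⊆) ⟩
  suc (length (as ++ bs))       ≡⟨ cong suc (length-++ as) ⟩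
  suc (length as ℕ.+ length bs) ≡⟨ ℕ.+-suc (length as) (length bs) ⟨
  length as ℕ.+ suc (length bs) ≡⟨ length-++ as ⟨
  length (as ++ x ∷ bs)         ∎
  where
  open ℕ.≤-Reasoning
  xs⊆ : xs ⊆ as ++ bs
  xs⊆ y∈xs with ∈-++⁻ as (x∷xs⊆ (there y∈xs))
  ... | inj₁ y∈as         = ∈-++⁺ˡ y∈as
  ... | inj₂ (here refl)  = contradiction refl (All.lookup x∉ y∈xs)
  ... | inj₂ (there y∈bs) = ∈-++⁺ʳ as y∈bs

-- Sums over primes and Szpiro ratios at a fixed index

sumOver : (ℕ → ℚ) → List ℕ → ℚ
sumOver f = foldr (λ p s → f p + s) 0ℚ

sumOver-↭ : ∀ f {ps qs} → ps ↭ qs → sumOver f ps ≡ sumOver f qs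
sumOver-↭ f ↭.refl                  = refl
sumOver-↭ f (↭.prep p r)            = cong (_+_ (f p)) (sumOver-↭ f r)
sumOver-↭ f (↭.swap {xs} p q r)     = trans
  (solve 3 (λ a b c → a :+ (b :+ c) := b :+ (a :+ c)) refl (f p) (f q) (sumOver f xs))
  (cong (λ s → f q + (f p + s)) (sumOver-↭ f r))
  where open +-*-Solver
sumOver-↭ f (↭.trans r r′)          = trans (sumOver-↭ f r) (sumOver-↭ f r′)

sumOver-mono : ∀ {f g} ps → (∀ {p} → p ∈ ps → f p ≤ g p) → sumOver f ps ≤ sumOver g ps
sumOver-mono []       h = ℚ.≤-refl
sumOver-mono (p ∷ ps) h = ℚ.+-mono-≤ (h (here refl)) (sumOver-mono ps (h ∘ there))

sumOver-cong : ∀ {f g} ps → (∀ {p} → p ∈ ps → f p ≡ g p) → sumOver f ps ≡ sumOver g ps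
sumOver-cong []       h = refl
sumOver-cong (p ∷ ps) h = cong₂ _+_ (h (here refl)) (sumOver-cong ps (h ∘ there))

0≤sumOver : ∀ {f} ps → (∀ p → 0ℚ ≤ f p) → 0ℚ ≤ sumOver f ps
0≤sumOver []       h = ℚ.≤-refl
0≤sumOver (p ∷ ps) h = ℚ.+-mono-≤ (h p) (0≤sumOver ps h)

≢2? : Decidable (_≢ 2)
≢2? p = ¬? (p ℕ.≟ 2)

sumOver-filter≤ : ∀ {f} ps → (∀ p → 0ℚ ≤ f p) → sumOver f (filter ≢2? ps) ≤ sumOver f ps
sumOver-filter≤ []       h = ℚ.≤-refl
sumOver-filter≤ {f} (p ∷ ps) h with does (≢2? p)
... | true  = ℚ.+-monoʳ-≤ (f p) (sumOver-filter≤ ps h)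
... | false =
  ℚ.≤-trans (ℚ.≤-reflexive (sym (ℚ.+-identityˡ _))) (ℚ.+-mono-≤ (h p) (sumOver-filter≤ ps h))

sumOver≤filter : ∀ {f} ps → (∀ p → 0ℚ ≤ f p) → Unique ps →
  sumOver f ps ≤ f 2 + sumOver f (filter ≢2? ps)
sumOver≤filter []       h u = ℚ.+-mono-≤ (h 2) ℚ.≤-refl
sumOver≤filter {f} (p ∷ ps) h (p∉ ∷ u) with p ℕ.≟ 2
-- Uniqueness excludes a second 2, so the filter keeps the whole tail.
... | yes refl =
  ℚ.≤-reflexive (cong (λ qs → f 2 + sumOver f qs) (sym (filter-all ≢2? (All.map (_∘ sym) p∉))))
... | no  p≢2  = begin
  f p + sumOver f ps
    ≤⟨ ℚ.+-monoʳ-≤ (f p) (sumOver≤filter ps h u) ⟩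
  f p + (f 2 + sumOver f (filter ≢2? ps))
    ≡⟨ solve 3 (λ a b c → a :+ (b :+ c) := b :+ (a :+ c))
                                             refl (f p) (f 2) (sumOver f (filter ≢2? ps)) ⟩
  f 2 + sumOver f (p ∷ filter ≢2? ps)
    ≡⟨ cong (λ qs → f 2 + sumOver f qs) (filter-accept ≢2? p≢2) ⟨
  f 2 + sumOver f (filter ≢2? (p ∷ ps)) ∎
  where
  open ℚ.≤-Reasoning
  open +-*-Solver

-- For a fixed mesh, a larger argument only appends nonnegative summands, so monotonicity of the
-- logarithm holds at every index and not merely in the limit.
logSum-mono : ∀ {m n} → m ℕ.≤ n → ∀ k → logSum m k ≤ logSum n k
logSum-mono {m} {n} m≤n k = subst (λ c → ∑ a t ≤ ∑ c t) (ℕ.m+[n∸m]≡n a≤b)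
  (ℚ.≤-trans (ℚ.≤-reflexive (sym (ℚ.+-identityʳ _)))
    (ℚ.≤-trans (ℚ.+-monoʳ-≤ (∑ a t) (0≤∑ (b ∸ a) λ i → 0≤/ 1 (k ℕ.+ suc (a ℕ.+ i))))
      (ℚ.≤-reflexive (sym (∑-++ a (b ∸ a) t)))))
  where
  a = (m ∸ 1) ℕ.* suc k
  b = (n ∸ 1) ℕ.* suc k
  a≤b : a ℕ.≤ b
  a≤b = ℕ.*-monoˡ-≤ (suc k) (ℕ.∸-monoˡ-≤ 1 m≤n)
  t : ℕ → ℚ
  t i = + 1 / (suc k ℕ.+ suc i)

module _ (k : ℕ) where

  logs : ℕ → ℚ
  logs p = logSum p k

  weightedLogs : (ℕ → ℕ) → ℕ → ℚ
  weightedLogs e p = + e p / 1 * logs p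

  seq-∑log : ∀ ps → seq (sumᴿ (map log ps)) k ≡ sumOver logs ps
  seq-∑log []       = refl
  seq-∑log (p ∷ ps) = cong (_+_ (logs p)) (seq-∑log ps)

  seq-∑weighted : ∀ e ps →
    seq (sumᴿ (map (λ p → fromℕ (e p) *ᴿ log p) ps)) k ≡ sumOver (weightedLogs e) ps
  seq-∑weighted e []       = refl
  seq-∑weighted e (p ∷ ps) = cong (_+_ (weightedLogs e p)) (seq-∑weighted e ps)

  0≤logs : ∀ p → 0ℚ ≤ logs p
  0≤logs p = 0≤logSum p k

  0<sumOver-logs : ∀ p ps → Prime p → 0ℚ < sumOver logs (p ∷ ps)
  0<sumOver-logs p ps pr =
    ℚ.+-mono-<-≤ (ℚ.<-≤-trans (ℚ.positive⁻¹ ℚ.½) (½≤logSum pr k)) (0≤sumOver ps 0≤logs)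

  -- Clearing the denominator gives a linear inequality, which is easier to carry from one set of
  -- primes to another and reads 0 ≤ 0 for the empty set.
  weightedRatio≤⇒ : ∀ {M} ps prs e → seq (weightedRatio ps prs e) k ≤ M →
    sumOver (weightedLogs e) ps ≤ M * sumOver logs ps
  weightedRatio≤⇒ {M} [] [] e _ = ℚ.≤-reflexive (sym (ℚ.*-zeroʳ M))
  weightedRatio≤⇒ {M} ps@(q ∷ qs) (pr ∷ prs) e h = begin
    n                 ≡⟨ ℚ.*-identityʳ n ⟨
    n * 1ℚ            ≡⟨ cong (_*_ n) (invℚ-inverse 0<d) ⟨
    n * (d * invℚ d)  ≡⟨ solve 3 (λ n d i → n :* (d :* i) := n :* i :* d) refl n d (invℚ d) ⟩
    n * invℚ d * d    ≤⟨ ℚ.*-monoʳ-≤-nonNeg d {{ℚ.nonNegative (ℚ.<⇒≤ 0<d)}} n/d≤M ⟩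
    M * d             ∎
    where
    open ℚ.≤-Reasoning
    open +-*-Solver
    n = sumOver (weightedLogs e) ps
    d = sumOver logs ps
    0<d = 0<sumOver-logs q qs pr
    n/d≤M : n * invℚ d ≤ M
    n/d≤M = subst (_≤ M) (cong₂ (λ a b → a * invℚ b) (seq-∑weighted e ps) (seq-∑log ps)) h

  -- The ratio of the empty list is 1 by convention, which the linear inequality does not see; hence
  -- the hypothesis 1 ≤ M.
  weightedRatio≤⇐ : ∀ {M} ps prs e → 1ℚ ≤ M →
    sumOver (weightedLogs e) ps ≤ M * sumOver logs ps → seq (weightedRatio ps prs e) k ≤ M
  weightedRatio≤⇐ {M} [] [] e 1≤M _ = 1≤M
  weightedRatio≤⇐ {M} ps@(q ∷ qs) (pr ∷ prs) e _ h =
    subst (_≤ M) (sym (cong₂ (λ a b → a * invℚ b) (seq-∑weighted e ps) (seq-∑log ps))) (begin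
    n * invℚ d        ≤⟨ ℚ.*-monoʳ-≤-nonNeg (invℚ d) {{ℚ.nonNegative (ℚ.<⇒≤ (0<invℚ 0<d))}} h ⟩
    M * d * invℚ d    ≡⟨ ℚ.*-assoc M d (invℚ d) ⟩
    M * (d * invℚ d)  ≡⟨ cong (_*_ M) (invℚ-inverse 0<d) ⟩
    M * 1ℚ            ≡⟨ ℚ.*-identityʳ M ⟩
    M                 ∎)
    where
    open ℚ.≤-Reasoning
    n = sumOver (weightedLogs e) ps
    d = sumOver logs ps
    0<d = 0<sumOver-logs q qs pr

module _ (D : ℤ) .{{_ : ℤ.NonZero D}} (Q : List ℕ) (e : ℕ → ℕ) (pd↭Q : primeDivisors ℤ.∣ D ∣ ↭ Q)
  (ord≡e : ∀ {q} → q ∈ Q → ord q ℤ.∣ D ∣ ≡ e q) (k : ℕ) where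

  private
    o : ℕ → ℕ
    o p = ord p ℤ.∣ D ∣
    pd = primeDivisors ℤ.∣ D ∣

    sumOver-weighted : sumOver (weightedLogs k o) pd ≡ sumOver (weightedLogs k e) Q
    sumOver-weighted = trans (sumOver-↭ (weightedLogs k o) pd↭Q)
      (sumOver-cong Q λ {p} p∈Q → cong (λ z → + z / 1 * logs k p) (ord≡e p∈Q))

  szpiro≤⇒ : ∀ {M} → seq (szpiro D) k ≤ M → sumOver (weightedLogs k e) Q ≤ M * sumOver (logs k) Q
  szpiro≤⇒ {M} h = begin
    sumOver (weightedLogs k e) Q
      ≡⟨ sumOver-weighted ⟨
    sumOver (weightedLogs k o) pd
      ≤⟨ weightedRatio≤⇒ k pd (primeDivisors-prime ℤ.∣ D ∣) o h ⟩
    M * sumOver (logs k) pd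
      ≡⟨ cong (_*_ M) (sumOver-↭ (logs k) pd↭Q) ⟩
    M * sumOver (logs k) Q ∎
    where open ℚ.≤-Reasoning

  szpiro≤⇐ : ∀ {M} → 1ℚ ≤ M → sumOver (weightedLogs k e) Q ≤ M * sumOver (logs k) Q →
    seq (szpiro D) k ≤ M
  szpiro≤⇐ {M} 1≤M h = weightedRatio≤⇐ k pd (primeDivisors-prime ℤ.∣ D ∣) o 1≤M (begin
    sumOver (weightedLogs k o) pd
      ≡⟨ sumOver-weighted ⟩
    sumOver (weightedLogs k e) Q
      ≤⟨ h ⟩
    M * sumOver (logs k) Q
      ≡⟨ cong (_*_ M) (sumOver-↭ (logs k) pd↭Q) ⟨
    M * sumOver (logs k) pd ∎)
    where open ℚ.≤-Reasoning

-- Primes and exponents of a subproduct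

module _ (D : ℤ) .{{_ : ℤ.NonZero D}} where

  private
    ps = primeDivisors ℤ.∣ D ∣
    e : ℕ → ℕ
    e p = ord p ℤ.∣ D ∣
    prs = primeDivisors-prime ℤ.∣ D ∣

  subproduct-∏^ : ∀ I → subproduct D I ≡ ∏^ e (select ps I)
  subproduct-∏^ I = cong product (trans (map-∘ (filter (_∈? I) (allFin (length ps))))
    (cong (map (λ p → p ^ e p)) (map-lookup-filter ps I)))

  module _ (I : Subset (ν D)) where

    private
      Q = select ps I
      n = subproduct D I
      primesQ : All Prime Q
      primesQ = All-select ps I prs
      uniqueQ : Unique Q
      uniqueQ = Unique-select ps I (primeDivisors-unique ℤ.∣ D ∣)
      ∏≢0 : ℕ.NonZero (∏^ e Q)
      ∏≢0 = subst ℕ.NonZero (subproduct-∏^ I) (subproduct≢0 D)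
      instance
        n≢0 : ℕ.NonZero n
        n≢0 = subproduct≢0 D {I}

    ord-subproduct-∈ : ∀ {q} → q ∈ select ps I → ord q n ≡ ord q ℤ.∣ D ∣
    ord-subproduct-∈ {q} q∈Q = trans (ord-cong q (subproduct-∏^ I) {{n≢0}} {{∏≢0}})
      (ord-∏^-∈ e Q primesQ uniqueQ q∈Q {{∏≢0}})

    ord-subproduct-∉ : ∀ {q} → q ∉ select ps I → ord q n ≡ 0
    ord-subproduct-∉ {q} q∉Q = trans (ord-cong q (subproduct-∏^ I) {{n≢0}} {{∏≢0}})
      (ord-∏^-∉ e Q primesQ q∉Q {{∏≢0}})

    -- Each prime of `D` has positive exponent, so every selected prime survives in the subproduct.
    -- Both lists are free of repetitions, so equal membership gives a permutation; the order in
    -- which `factorise` lists the primes is not controlled.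
    primeDivisors-subproduct : primeDivisors n ↭ select ps I
    primeDivisors-subproduct = Unique-⊆⇒↭ (primeDivisors-unique n) uniqueQ
      (λ {q} q∈ → decidable-stable (q ∈ℕ? Q)
        λ q∉Q → ℕ.<⇒≢ (∈primeDivisors⁻ n q∈) (sym (ord-subproduct-∉ q∉Q)))
      (λ q∈Q → ∈primeDivisors⁺ n (subst (0 ℕ.<_) (sym (ord-subproduct-∈ q∈Q))
        (All.lookup (All-select ps I (All.tabulate (∈primeDivisors⁻ ℤ.∣ D ∣))) q∈Q)))

    szpiro-subproduct≤⇒ : ∀ k {M} → seq (szpiro (+ n)) k ≤ M →
      sumOver (weightedLogs k e) (select ps I) ≤ M * sumOver (logs k) (select ps I)
    szpiro-subproduct≤⇒ = szpiro≤⇒ (+ n) Q e primeDivisors-subproduct ord-subproduct-∈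

    szpiro-subproduct≤⇐ : ∀ k {M} → 1ℚ ≤ M →
      sumOver (weightedLogs k e) (select ps I) ≤ M * sumOver (logs k) (select ps I) →
      seq (szpiro (+ n)) k ≤ M
    szpiro-subproduct≤⇐ = szpiro≤⇐ (+ n) Q e primeDivisors-subproduct ord-subproduct-∈

-- The combining function c is kept abstract, so that applying the lemmas to
-- depletedSzpiro does not make Agda unfold and compare whole Szpiro ratios.
module _ {I : Set} (s : I → ℝ) (b : ℝ) (c : I → ℝ → ℝ) (k : ℕ)
  (c-⊓ : ∀ i m → seq (c i m) k ≡ seq (s i) k ⊓ seq m k) where

  private
    minimum : List I → ℝ
    minimum = foldr c b

  minimum-≤ : ∀ {i} is → i ∈ is → seq (foldr c b is) k ≤ seq (s i) k
  minimum-≤ (j ∷ is) j∈ = ℚ.≤-trans (ℚ.≤-reflexive (c-⊓ j (minimum is))) (below j∈)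
    where
    below : ∀ {i} → i ∈ j ∷ is → seq (s j) k ⊓ seq (minimum is) k ≤ seq (s i) k
    below (here refl)  = ℚ.p⊓q≤p (seq (s j) k) (seq (minimum is) k)
    below (there i∈is) = ℚ.≤-trans (ℚ.p⊓q≤q (seq (s j) k) (seq (minimum is) k)) (minimum-≤ is i∈is)

  -- `i₀` accounts for the starting value of the fold, which for `depletedSzpiro` is the full index
  -- set. The minimiser is found at the single index `k` by deciding comparisons of rationals.
  minimum-attained : ∀ {i₀} → seq b k ≡ seq (s i₀) k →
    ∀ is → ∃ λ i → i ∈ i₀ ∷ is × seq (foldr c b is) k ≡ seq (s i) k
  minimum-attained {i₀} b≡ []       = i₀ , here refl , b≡
  minimum-attained {i₀} b≡ (i ∷ is) =
    let j , j∈ , eq = choose (ℚ.⊓-sel (seq (s i) k) (seq (minimum is) k)) (minimum-attained b≡ is)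
    in j , j∈ , trans (c-⊓ i (minimum is)) eq
    where
    choose : ∀ {m x} → m ≡ seq (s i) k ⊎ m ≡ x → (∃ λ j → j ∈ i₀ ∷ is × x ≡ seq (s j) k) →
      ∃ λ j → j ∈ i₀ ∷ i ∷ is × m ≡ seq (s j) k
    choose (inj₁ eq) _                      = i , there (here refl) , eq
    choose (inj₂ eq) (j , here j≡i₀ , eq′)  = j , here j≡i₀ , trans eq eq′
    choose (inj₂ eq) (j , there j∈is , eq′) = j , there (there j∈is) , trans eq eq′

module _ (D : ℤ) .{{_ : ℤ.NonZero D}} (J k : ℕ) where

  private
    Large? : Decidable (λ (I : Subset (ν D)) → ν D ∸ J ℕ.≤ Subset.∣ I ∣)
    Large? I = ν D ∸ J ℕ.≤? Subset.∣ I ∣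

  depletedSzpiro-attained : ∃ λ I → ν D ∸ J ℕ.≤ Subset.∣ I ∣ ×
    seq (depletedSzpiro D J) k ≡ seq (szpiro (+ subproduct D I) {{subproduct≢0 D}}) k
  depletedSzpiro-attained =
    proj₁ attained , ∣∣≥ (proj₁ attained) (proj₁ (proj₂ attained)) , proj₂ (proj₂ attained)
    where
    attained : ∃ λ I → I ∈ ⊤ ∷ filter Large? (subsets (ν D)) ×
      seq (depletedSzpiro D J) k ≡ seq (szpiro (+ subproduct D I) {{subproduct≢0 D}}) k
    attained = minimum-attained (λ I → szpiro (+ subproduct D I) {{subproduct≢0 D}})
      _ _ k (λ _ _ → refl) refl _
    ∣∣≥ : ∀ I → I ∈ ⊤ ∷ filter Large? (subsets (ν D)) → ν D ∸ J ℕ.≤ Subset.∣ I ∣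
    ∣∣≥ _ (here refl) = ℕ.≤-trans (ℕ.m∸n≤m (ν D) J) (ℕ.≤-reflexive (sym (∣⊤∣≡n (ν D))))
    ∣∣≥ _ (there I∈)  = proj₂ (∈-filter⁻ Large? {xs = subsets (ν D)} I∈)

weightedLogs-mono : ∀ k {m n} p → m ℕ.≤ n → + m / 1 * logs k p ≤ + n / 1 * logs k p
weightedLogs-mono k {m} {n} p m≤n = ℚ.*-monoʳ-≤-nonNeg (logs k p) {{ℚ.nonNegative (0≤logs k p)}}
  (/≤/ m 0 n 0 (ℕ.*-monoˡ-≤ 1 m≤n))

0≤weightedLogs : ∀ k e p → 0ℚ ≤ weightedLogs k e p
0≤weightedLogs k e p = ℚ.≤-trans (ℚ.≤-reflexive (sym (ℚ.*-zeroˡ (logs k p))))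
  (ℚ.*-monoʳ-≤-nonNeg (logs k p) {{ℚ.nonNegative (0≤logs k p)}} (0≤/ (e p) 0))

module _ (k : ℕ) {M : ℚ} (0≤M : 0ℚ ≤ M) (e e′ : ℕ → ℕ) (Q : List ℕ) (primes : All Prime Q) (unique : Unique Q)
  (e≤e′ : ∀ {p} → p ∈ filter ≢2? Q → e p ℕ.≤ e′ p)
  (bound : sumOver (weightedLogs k e′) Q ≤ M * sumOver (logs k) Q) where

  -- Removing 2 at most halves the sum of the logarithms, unless nothing is left.
  remove-2 : sumOver (weightedLogs k e) (filter ≢2? Q) ≤ (M + M) * sumOver (logs k) (filter ≢2? Q)
  remove-2 = go (filter ≢2? Q) refl (All.filter⁺ ≢2? primes)
    where
    open ℚ.≤-Reasoning
    open +-*-Solver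
    go : ∀ Q′ → Q′ ≡ filter ≢2? Q → All Prime Q′ →
      sumOver (weightedLogs k e) Q′ ≤ (M + M) * sumOver (logs k) Q′
    go [] _ _ = ℚ.≤-reflexive (sym (ℚ.*-zeroʳ (M + M)))
    go Q′@(q ∷ qs) Q′≡ (pr ∷ _) = begin
      sumOver (weightedLogs k e) Q′
        ≤⟨ sumOver-mono Q′ (λ {p} p∈ → weightedLogs-mono k p (e≤e′ (subst (p ∈_) Q′≡ p∈))) ⟩
      sumOver (weightedLogs k e′) Q′
        ≡⟨ cong (sumOver (weightedLogs k e′)) Q′≡ ⟩
      sumOver (weightedLogs k e′) (filter ≢2? Q) ≤⟨ sumOver-filter≤ Q (0≤weightedLogs k e′) ⟩
      sumOver (weightedLogs k e′) Q
        ≤⟨ bound ⟩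
      M * sumOver (logs k) Q
        ≤⟨ ℚ.*-monoˡ-≤-nonNeg M {{ℚ.nonNegative 0≤M}} (sumOver≤filter Q (0≤logs k) unique) ⟩
      M * (logs k 2 + sumOver (logs k) (filter ≢2? Q))
        ≡⟨ cong (λ z → M * (logs k 2 + sumOver (logs k) z)) Q′≡ ⟨
      M * (logs k 2 + sumOver (logs k) Q′)
        ≤⟨ ℚ.*-monoˡ-≤-nonNeg M {{ℚ.nonNegative 0≤M}} (ℚ.+-monoˡ-≤ (sumOver (logs k) Q′) log2≤) ⟩
      M * (sumOver (logs k) Q′ + sumOver (logs k) Q′)
        ≡⟨ solve 2 (λ m s → m :* (s :+ s) := (m :+ m) :* s) refl M (sumOver (logs k) Q′) ⟩
      (M + M) * sumOver (logs k) Q′ ∎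
      where
      log2≤ : logs k 2 ≤ sumOver (logs k) Q′
      log2≤ = begin
        logs k 2
          ≤⟨ logSum-mono (ℕ.nonTrivial⇒n>1 q {{prime⇒nonTrivial pr}}) k ⟩
        logs k q
          ≡⟨ ℚ.+-identityʳ (logs k q) ⟨
        logs k q + 0ℚ
          ≤⟨ ℚ.+-monoʳ-≤ (logs k q) (0≤sumOver qs (0≤logs k)) ⟩
        sumOver (logs k) Q′ ∎

-- Transfer of the depleted bound from one integer to another

module _ (D X : ℤ) .{{_ : ℤ.NonZero D}} .{{_ : ℤ.NonZero X}}
  (ord-X≤ord-D : ∀ p → Prime p → p ≢ 2 → ord p ℤ.∣ X ∣ ℕ.≤ ord p ℤ.∣ D ∣)
  (ord-X>0 : ∀ p → Prime p → p ≢ 2 → 0 ℕ.< ord p ℤ.∣ D ∣ → 0 ℕ.< ord p ℤ.∣ X ∣)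
  (J k : ℕ) {M : ℚ} (1≤M : 1ℚ ≤ M) where

  private
    psD = primeDivisors ℤ.∣ D ∣
    psX = primeDivisors ℤ.∣ X ∣
    0≤M : 0ℚ ≤ M
    0≤M = ℚ.≤-trans (ℚ.nonNegative⁻¹ 1ℚ) 1≤M
    1≤M+M : 1ℚ ≤ M + M
    1≤M+M = ℚ.≤-trans 1≤M (ℚ.≤-trans (ℚ.≤-reflexive (sym (ℚ.+-identityʳ M))) (ℚ.+-monoʳ-≤ M 0≤M))

    psX⊆ : psX ⊆ 2 ∷ psD
    psX⊆ {p} p∈ with p ℕ.≟ 2
    ... | yes p≡2 = here p≡2
    ... | no  p≢2 = there (∈primeDivisors⁺ ℤ.∣ D ∣ (ℕ.≤-trans (∈primeDivisors⁻ ℤ.∣ X ∣ p∈)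
      (ord-X≤ord-D p (All.lookup (primeDivisors-prime ℤ.∣ X ∣) p∈) p≢2)))

    module _ (I : Subset (ν D)) (large : ν D ∸ J ℕ.≤ Subset.∣ I ∣) where

      Q = select psD I
      Q′ = filter ≢2? Q

      primesQ : All Prime Q
      primesQ = All-select psD I (primeDivisors-prime ℤ.∣ D ∣)

      uniqueQ : Unique Q
      uniqueQ = Unique-select psD I (primeDivisors-unique ℤ.∣ D ∣)

      Q⊆ : Q ⊆ 2 ∷ Q′
      Q⊆ {p} p∈ with p ℕ.≟ 2
      ... | yes p≡2 = here p≡2
      ... | no  p≢2 = there (∈-filter⁺ ≢2? p∈ p≢2)

      Q′⊆psX : Q′ ⊆ psX
      Q′⊆psX {p} p∈ = let p∈Q , p≢2 = ∈-filter⁻ ≢2? {xs = Q} p∈ in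
        ∈primeDivisors⁺ ℤ.∣ X ∣ (ord-X>0 p (All.lookup primesQ p∈Q) p≢2
          (All.lookup (All-select psD I (All.tabulate (∈primeDivisors⁻ ℤ.∣ D ∣))) p∈Q))

      -- `Q′` lists primes of `X` in the order inherited from `D`. Filtering `psX` by membership in
      -- `Q′` yields the corresponding index set for `X`, which recovers `Q′` up to order.
      I′ : Subset (ν X)
      I′ = proj₁ (filter-as-select (_∈ℕ? Q′) psX)

      select-I′ : select psX I′ ↭ Q′
      select-I′ = subst (_↭ Q′) (sym (proj₂ (filter-as-select (_∈ℕ? Q′) psX)))
        (Unique-⊆⇒↭ (Unique.filter⁺ (_∈ℕ? Q′) (primeDivisors-unique ℤ.∣ X ∣)) (Unique.filter⁺ ≢2? uniqueQ)
          (λ p∈ → proj₂ (∈-filter⁻ (_∈ℕ? Q′) {xs = psX} p∈))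
          (λ p∈ → ∈-filter⁺ (_∈ℕ? Q′) (Q′⊆psX p∈) p∈))

      -- One place in the bound is lost when 2 leaves Q, the other when 2 divides X but not D.
      large′ : ν X ∸ (2 ℕ.+ J) ℕ.≤ Subset.∣ I′ ∣
      large′ = ℕ.m≤n+o⇒m∸n≤o (ν X) (2 ℕ.+ J) (begin
        ν X                            ≤⟨ Unique-⊆⇒length≤ (primeDivisors-unique ℤ.∣ X ∣) psX⊆ ⟩
        suc (ν D)
          ≤⟨ ℕ.s≤s (ℕ.≤-trans (ℕ.m≤n+m∸n (ν D) J) (ℕ.+-monoʳ-≤ J large)) ⟩
        suc (J ℕ.+ Subset.∣ I ∣)       ≡⟨ cong (λ z → suc (J ℕ.+ z)) (length-select psD I) ⟨
        suc (J ℕ.+ length Q)           ≤⟨ ℕ.s≤s (ℕ.+-monoʳ-≤ J (Unique-⊆⇒length≤ uniqueQ Q⊆)) ⟩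
        suc (J ℕ.+ suc (length Q′))    ≡⟨ cong suc (ℕ.+-suc J (length Q′)) ⟩
        2 ℕ.+ J ℕ.+ length Q′
          ≡⟨ cong (2 ℕ.+ J ℕ.+_) (trans (sym (length-select psX I′)) (↭-length select-I′)) ⟨
        2 ℕ.+ J ℕ.+ Subset.∣ I′ ∣      ∎)
        where open ℕ.≤-Reasoning

      eX eD : ℕ → ℕ
      eX p = ord p ℤ.∣ X ∣
      eD p = ord p ℤ.∣ D ∣

      szpiro-I′≤ : seq (szpiro (+ subproduct D I) {{subproduct≢0 D}}) k ≤ M →
        seq (szpiro (+ subproduct X I′) {{subproduct≢0 X}}) k ≤ M + M
      szpiro-I′≤ h = szpiro-subproduct≤⇐ X I′ k 1≤M+M (begin
        sumOver (weightedLogs k eX) (select psX I′)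
          ≡⟨ sumOver-↭ (weightedLogs k eX) select-I′ ⟩
        sumOver (weightedLogs k eX) Q′
          ≤⟨ remove-2 k 0≤M eX eD Q primesQ uniqueQ eX≤eD
                                                   (szpiro-subproduct≤⇒ D I k h) ⟩
        (M + M) * sumOver (logs k) Q′
          ≡⟨ cong (_*_ (M + M)) (sumOver-↭ (logs k) select-I′) ⟨
        (M + M) * sumOver (logs k) (select psX I′) ∎)
        where
        open ℚ.≤-Reasoning
        eX≤eD : ∀ {p} → p ∈ Q′ → eX p ℕ.≤ eD p
        eX≤eD {p} p∈ = let p∈Q , p≢2 = ∈-filter⁻ ≢2? {xs = Q} p∈ in
          ord-X≤ord-D p (All.lookup primesQ p∈Q) p≢2

  transfer : seq (depletedSzpiro D J) k ≤ M →
    ∃ λ I → ν X ∸ (2 ℕ.+ J) ℕ.≤ Subset.∣ I ∣ × seq (szpiro (+ subproduct X I) {{subproduct≢0 X}}) k ≤ M + M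
  transfer h = let I , large , eq = depletedSzpiro-attained D J k in
    I′ I large , large′ I large , szpiro-I′≤ I large (subst (_≤ M) eq h)

-- The index `N` is taken from the Cauchy modulus of `x`, not from the doubly negated hypothesis.
-- What remains is a single inequality between rationals, which is decidable and therefore stable.
-- The three thirds of ε pay for passing from `n` to `N`, from `N` to a late index, and for the
-- slack in the hypothesis there.
≤ᴿ-stable : ∀ x q → ¬ ¬ (x ≤ᴿ fromℚ q) → x ≤ᴿ fromℚ q
≤ᴿ-stable x q ¬¬x≤q ε 0<ε = N , λ n N≤n → begin
  seq x n              ≤⟨ ∣-∣≤⇒≤+ (seq x n) (seq x N) (close n N N≤n ℕ.≤-refl) ⟩
  seq x N + η          ≤⟨ ℚ.+-monoˡ-≤ η xN≤ ⟩
  q + η + η + η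
    ≡⟨ solve 2 (λ q e → q :+ e :* con (+ 1 / 3) :+ e :* con (+ 1 / 3) :+ e :* con (+ 1 / 3)
                                     := q :+ e) refl q ε ⟩
  q + ε                ∎
  where
  open ℚ.≤-Reasoning
  open +-*-Solver
  η = ε * (+ 1 / 3)
  0<η : 0ℚ < η
  0<η = 0<p*q 0<ε (ℚ.positive⁻¹ (+ 1 / 3))
  N = proj₁ (cauchy x η 0<η)
  close = proj₂ (cauchy x η 0<η)
  xN≤ : seq x N ≤ q + η + η
  xN≤ = decidable-stable (seq x N ℚ.≤? q + η + η) λ xN≰ → ¬¬x≤q λ x≤q → xN≰
    (let N′ , below = x≤q η 0<η
         n = N ℕ.+ N′
     in begin
     seq x N         ≤⟨ ∣-∣≤⇒≤+ (seq x N) (seq x n) (close N n ℕ.≤-refl (ℕ.m≤m+n N N′)) ⟩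
     seq x n + η     ≤⟨ ℚ.+-monoˡ-≤ η (below n (ℕ.m≤n+m N′ N)) ⟩
     q + η + η       ∎)

-- This trades a real bound for one rational constant valid at all late indices, the form required
-- by the index-by-index argument. The extra 1 is the slack of `_≤ᴿ_` at ε = 1.
≤ᴿ⇒≤ : ∀ {x y} → x ≤ᴿ y → ∀ {B N₀} → (∀ n → N₀ ℕ.≤ n → ℚ.∣ seq y n ∣ ≤ B) →
  ∃ λ N → ∀ n → N ℕ.≤ n → seq x n ≤ B + 1ℚ
≤ᴿ⇒≤ {x} {y} x≤y {B} {N₀} ∣y∣≤B = let N , below = x≤y 1ℚ (ℚ.positive⁻¹ 1ℚ) in
  N₀ ℕ.+ N , λ n h → begin
  seq x n            ≤⟨ below n (ℕ.m+n≤o⇒n≤o N₀ h) ⟩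
  seq y n + 1ℚ       ≤⟨ ℚ.+-monoˡ-≤ 1ℚ (∣-∣≤⇒≤+ (seq y n) 0ℚ (∣y-0∣≤B n (ℕ.m+n≤o⇒m≤o N₀ h))) ⟩
  0ℚ + B + 1ℚ        ≡⟨ cong (_+ 1ℚ) (ℚ.+-identityˡ B) ⟩
  B + 1ℚ             ∎
  where
  open ℚ.≤-Reasoning
  ∣y-0∣≤B : ∀ n → N₀ ℕ.≤ n → ℚ.∣ seq y n - 0ℚ ∣ ≤ B
  ∣y-0∣≤B n N₀≤n = subst (λ z → ℚ.∣ z ∣ ≤ B) (sym (ℚ.+-identityʳ (seq y n))) (∣y∣≤B n N₀≤n)

-- depletedSzpiro X (2 + J) is given as foldr c b Is: comparing two copies of it that differ in
-- the proof of X ≢ 0 is expensive for Agda, whereas c, b and Is are cheap to infer.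
module _ (J : ℕ) (M : ℚ) (1≤M : 1ℚ ≤ M)
  (A B C : ℤ) .{{_ : ℤ.NonZero A}} .{{_ : ℤ.NonZero B}} .{{_ : ℤ.NonZero C}}
  (sum≡0 : A ℤ.+ B ℤ.+ C ≡ + 0) (gcd≡1 : ℤ.gcd (ℤ.gcd A B) C ≡ + 1)
  (depleted≤M : ∀ E D .(D≢0 : ℤ.NonZero D) → IsMinimalDiscriminant E D {{D≢0}} →
    ∃ λ N → ∀ n → N ℕ.≤ n → seq (depletedSzpiro D {{D≢0}} J) n ≤ M)
  (X : ℤ) .{{_ : ℤ.NonZero X}} (X≡ABC : X ≡ A ℤ.* B ℤ.* C)
  (b : ℝ) (c : Subset (ν X) → ℝ → ℝ)
  (c-⊓ : ∀ k I m → seq (c I m) k ≡ seq (szpiro (+ subproduct X I) {{subproduct≢0 X}}) k ⊓ seq m k)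
  (Is : List (Subset (ν X))) (large⇒∈ : ∀ I → ν X ∸ (2 ℕ.+ J) ℕ.≤ Subset.∣ I ∣ → I ∈ Is) where

  open Frey A B C sum≡0 gcd≡1

  private
    ord-X : ∀ p → ord p ℤ.∣ X ∣ ≡ ord p ℤ.∣ ABC ∣
    ord-X p = ord-cong p (cong ℤ.∣_∣ X≡ABC)

    viaMinimalDiscriminant : FreyDiscriminant A B C sum≡0 gcd≡1 → foldr c b Is ≤ᴿ fromℚ (M + M)
    viaMinimalDiscriminant d ε 0<ε = N , λ n N≤n →
      let I , large , I≤ = transfer D X {{D≢0}}
            (λ p pr p≢2 → subst (ℕ._≤ ord p ℤ.∣ D ∣ {{D≢0}}) (sym (ord-X p)) (ord-ABC≤ord-D p pr p≢2))
            (λ p pr p≢2 0<ord → subst (0 ℕ.<_) (sym (ord-X p)) (ord-ABC>0 p pr p≢2 0<ord))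
            J n 1≤M (below n N≤n)
      in ℚ.≤-trans
        (minimum-≤ (λ I → szpiro (+ subproduct X I) {{subproduct≢0 X}}) b c n (c-⊓ n) Is
          (large⇒∈ I large))
        (ℚ.≤-trans I≤ (ℚ.≤-trans (ℚ.≤-reflexive (sym (ℚ.+-identityʳ (M + M))))
          (ℚ.+-monoʳ-≤ (M + M) (ℚ.<⇒≤ 0<ε))))
      where
      open FreyDiscriminant d
      N = proj₁ (depleted≤M curve D D≢0 isMinimal)
      below = proj₂ (depleted≤M curve D D≢0 isMinimal)

  depleted-≤ᴿ : foldr c b Is ≤ᴿ fromℚ (M + M)
  depleted-≤ᴿ = ≤ᴿ-stable (foldr c b Is) (M + M)
    λ ¬≤ → freyDiscriminant A B C sum≡0 gcd≡1 λ d → ¬≤ (viaMinimalDiscriminant d)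

proposition11 : PrimeDepletedSzpiro → PrimeDepletedABC
proposition11 (J , C₃ , szpiro≤C₃) = 2 ℕ.+ J , fromℚ (M + M) , λ A B C sum≡0 gcd≡1 →
  depleted-≤ᴿ J M 1≤M A B C sum≡0 gcd≡1 depleted≤M
    (A ℤ.* B ℤ.* C) {{Frey.ABC≢0 A B C sum≡0 gcd≡1}} refl
    _ _ (λ _ _ _ → refl) _ (λ I → ∈-filter⁺ _ (∈-subsets I))
  where
  bounded = eventuallyBounded (seq C₃) (cauchy C₃)
  -- The added 1 serves twice: it absorbs the slack in `_≤ᴿ_`, and it ensures 1 ≤ M, which covers
  -- the case where no prime remains and the ratio is 1.
  M = proj₁ bounded + 1ℚ
  1≤M : 1ℚ ≤ M
  1≤M =
    ℚ.≤-trans (ℚ.≤-reflexive (sym (ℚ.+-identityˡ 1ℚ))) (ℚ.+-monoˡ-≤ 1ℚ (ℚ.<⇒≤ (proj₁ (proj₂ bounded))))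
  depleted≤M : ∀ E D .(D≢0 : ℤ.NonZero D) → IsMinimalDiscriminant E D {{D≢0}} →
    ∃ λ N → ∀ n → N ℕ.≤ n → seq (depletedSzpiro D {{D≢0}} J) n ≤ M
  depleted≤M E D D≢0 isMinimal = ≤ᴿ⇒≤ {depletedSzpiro D {{D≢0}} J} {C₃}
    (szpiro≤C₃ E D {{D≢0}} isMinimal) (proj₂ (proj₂ (proj₂ bounded)))
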